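{- Let $\delta$ be a measurable cardinal and let $\nu>\delta$ be a $\delta$-inaccessible cardinal with $\mathrm{cof}(\nu)\neq\delta$. If $\kappa$ is a cardinal with $\nu\leq\kappa\leq\nu^+$, then there is no good $\Sigma_1(\kappa)$-wellordering of $\mathcal{P}(\kappa)$.
   Context: We work in ZFC. For cardinals $\delta<\nu$, $\nu$ is $\delta$-inaccessible if $\lambda^\delta<\nu$ holds for all $\lambda<\nu$. For sets $y_0,\ldots,y_{n-1}$, a set $X$ is $\Sigma_1(y_0,\ldots,y_{n-1})$-definable if there is a $\Sigma_1$-formula $\varphi(v_0,\ldots,v_n)$ (in the Lévy hierarchy, in the language of set theory) with $X=\{x\mid\varphi(x,y_0,\ldots,y_{n-1})\}$. A wellordering $\lhd$ of a set $X$ is a good $\Sigma_1(y_0,\ldots,y_{n-1})$-wellordering of $X$ if the set $I(\lhd)=\{\{x\in X\mid x\lhd y\}\mid y\in X\}$ of all proper initial segments of $\lhd$ is $\Sigma_1(y_0,\ldots,y_{n-1})$-definable. -}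

module Defs where

open import Data.Fin.Base using (Fin; zero; suc)
open import Data.Nat.Base using (ℕ; suc)
open import Data.Product using (∃-syntax; ∃!; _×_)
open import Data.Sum.Base using (_⊎_)
open import Data.Vec.Base using (Vec; _∷_; lookup)
open import Function.Bundles using (_⇔_)
import Level
open import Relation.Binary.Core using (Rel)
open import Relation.Binary.PropositionalEquality.Core using (_≡_)
open import Relation.Nullary.Negation.Core using (¬_)
open import Relation.Unary using (Pred)

infix  7 _∈̇_ _≡̇_
infix  6 ¬̇_
infixr 5 _∧̇_
infixr 4 _∨̇_
infixr 3 _⇒̇_
infix  2 ∀̇_ ∃̇_

-- First-order formulas of the language of set theory with free variables
-- v₀ , … , vₙ₋₁, as de Bruijn indices: a quantifier binds index zero.
data Formula (n : ℕ) : Set where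
  _∈̇_ _≡̇_      : Fin n → Fin n → Formula n
  ¬̇_            : Formula n → Formula n
  _∧̇_ _∨̇_ _⇒̇_ : Formula n → Formula n → Formula n
  ∀̇_ ∃̇_        : Formula (suc n) → Formula n

-- The bound of a bounded quantifier is a variable vᵢ
-- of the ambient context, which is  suc i  under the binder.
data Δ₀ {n : ℕ} : Formula n → Set where
  mem  : ∀ i j → Δ₀ (i ∈̇ j)
  eq   : ∀ i j → Δ₀ (i ≡̇ j)
  neg  : ∀ {φ} → Δ₀ φ → Δ₀ (¬̇ φ)
  conj : ∀ {φ ψ} → Δ₀ φ → Δ₀ ψ → Δ₀ (φ ∧̇ ψ)
  disj : ∀ {φ ψ} → Δ₀ φ → Δ₀ ψ → Δ₀ (φ ∨̇ ψ)
  impl : ∀ {φ ψ} → Δ₀ φ → Δ₀ ψ → Δ₀ (φ ⇒̇ ψ)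
  ball : ∀ i {φ} → Δ₀ φ → Δ₀ (∀̇ (zero ∈̇ suc i ⇒̇ φ))
  bex  : ∀ i {φ} → Δ₀ φ → Δ₀ (∃̇ (zero ∈̇ suc i ∧̇ φ))

-- Blocks of unbounded existential quantifiers of any length are allowed.
data Σ₁ {n : ℕ} : Formula n → Set where
  delta₀ : ∀ {φ} → Δ₀ φ → Σ₁ φ
  exists : ∀ {φ} → Σ₁ φ → Σ₁ (∃̇ φ)

record Structure (ℓ : Level.Level) : Set (Level.suc ℓ) where
  infix 4 _∈_
  field
    Carrier : Set ℓ
    _∈_     : Rel Carrier ℓ

module SetTheory {ℓ : Level.Level} (𝓥 : Structure ℓ) where
  open Structure 𝓥 renaming (Carrier to V) public

  infix 4 _⊆_ _≤_

  Sat : ∀ {n} → Formula n → Vec V n → Set ℓ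
  Sat (i ∈̇ j) ρ = lookup ρ i ∈ lookup ρ j
  Sat (i ≡̇ j) ρ = lookup ρ i ≡ lookup ρ j
  Sat (¬̇ φ)   ρ = ¬ Sat φ ρ
  Sat (φ ∧̇ ψ) ρ = Sat φ ρ × Sat ψ ρ
  Sat (φ ∨̇ ψ) ρ = Sat φ ρ ⊎ Sat ψ ρ
  Sat (φ ⇒̇ ψ) ρ = Sat φ ρ → Sat ψ ρ
  Sat (∀̇ φ)   ρ = ∀ x → Sat φ (x ∷ ρ)
  Sat (∃̇ φ)   ρ = ∃[ x ] Sat φ (x ∷ ρ)

  -- A class {x ∣ P x} is Σ₁(y₀,…,yₙ₋₁)-definable.
  Σ₁-Definable : ∀ {n} → Vec V n → Pred V ℓ → Set ℓ
  Σ₁-Definable {n} ys P =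
    ∃[ φ ] Σ₁ {suc n} φ × (∀ x → P x ⇔ Sat φ (x ∷ ys))

  _⊆_ : Rel V ℓ
  x ⊆ y = ∀ z → z ∈ x → z ∈ y

  IsEmpty Nonempty : Pred V ℓ
  IsEmpty  x = ∀ z → ¬ z ∈ x
  Nonempty x = ∃[ z ] z ∈ x

  -- p = {x , y}
  IsPair : V → V → V → Set ℓ
  IsPair p x y = ∀ z → z ∈ p ⇔ (z ≡ x ⊎ z ≡ y)

  -- p = {{x} , {x , y}}
  IsOrderedPair : V → V → V → Set ℓ
  IsOrderedPair p x y = ∀ z → z ∈ p ⇔ (IsPair z x x ⊎ IsPair z x y)

  -- s = x ∪ {x}
  IsSuccessor : V → V → Set ℓ
  IsSuccessor s x = ∀ z → z ∈ s ⇔ (z ∈ x ⊎ z ≡ x)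

  IsUnion : V → V → Set ℓ
  IsUnion u x = ∀ z → z ∈ u ⇔ (∃[ y ] y ∈ x × z ∈ y)

  IsPowerSet : V → V → Set ℓ
  IsPowerSet P x = ∀ z → z ∈ P ⇔ z ⊆ x

  IsInductive : Pred V ℓ
  IsInductive w = (∀ e → IsEmpty e → e ∈ w)
                × (∀ x s → x ∈ w → IsSuccessor s x → s ∈ w)

  IsOmega : Pred V ℓ
  IsOmega w = IsInductive w × (∀ v → IsInductive v → w ⊆ v)

  record ZFC : Set ℓ where
    field
      extensionality : ∀ x y → (∀ z → z ∈ x ⇔ z ∈ y) → x ≡ y
      foundation     : ∀ x → Nonempty x → ∃[ y ] y ∈ x × (∀ z → z ∈ y → ¬ z ∈ x)
      pairing        : ∀ x y → ∃[ p ] IsPair p x y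
      union          : ∀ x → ∃[ u ] IsUnion u x
      powerSet       : ∀ x → ∃[ P ] IsPowerSet P x
      infinity       : ∃[ w ] IsInductive w
      separation     : ∀ {n} (φ : Formula (suc n)) (ρ : Vec V n) a →
                       ∃[ b ] (∀ x → x ∈ b ⇔ (x ∈ a × Sat φ (x ∷ ρ)))
      replacement    : ∀ {n} (φ : Formula (suc (suc n))) (ρ : Vec V n) a →
                       (∀ x → x ∈ a → ∀ y y′ →
                         Sat φ (x ∷ y ∷ ρ) → Sat φ (x ∷ y′ ∷ ρ) → y ≡ y′) →
                       ∃[ b ] (∀ y → y ∈ b ⇔ (∃[ x ] x ∈ a × Sat φ (x ∷ y ∷ ρ)))
      choice         : ∀ a → (∀ x → x ∈ a → Nonempty x) →
                       (∀ x y z → x ∈ a → y ∈ a → z ∈ x → z ∈ y → x ≡ y) →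
                       ∃[ c ] (∀ x → x ∈ a → ∃! _≡_ λ z → z ∈ x × z ∈ c)

  -- ⟨x , y⟩ ∈ r
  Related : V → V → V → Set ℓ
  Related r x y = ∃[ p ] IsOrderedPair p x y × p ∈ r

  -- r ⊆ a × b
  IsRelation : V → V → V → Set ℓ
  IsRelation r a b =
    ∀ p → p ∈ r → ∃[ x ] ∃[ y ] x ∈ a × y ∈ b × IsOrderedPair p x y

  IsFunction : V → V → V → Set ℓ
  IsFunction f a b =
    IsRelation f a b × (∀ x → x ∈ a → ∃! _≡_ λ y → Related f x y)

  IsBijection : V → V → V → Set ℓ
  IsBijection f a b =
    IsFunction f a b
    × (∀ x x′ y → Related f x y → Related f x′ y → x ≡ x′)
    × (∀ y → y ∈ b → ∃[ x ] Related f x y)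

  Equinumerous : V → V → Set ℓ
  Equinumerous a b = ∃[ f ] IsBijection f a b

  record WellOrders (_<_ : Rel V ℓ) (X : V) : Set ℓ where
    field
      irrefl  : ∀ x → x ∈ X → ¬ x < x
      trans   : ∀ x y z → x ∈ X → y ∈ X → z ∈ X → x < y → y < z → x < z
      total   : ∀ x y → x ∈ X → y ∈ X → x < y ⊎ x ≡ y ⊎ y < x
      minimum : ∀ s → s ⊆ X → Nonempty s →
                ∃[ m ] m ∈ s × (∀ x → x ∈ s → m ≡ x ⊎ m < x)

  IsWellOrdering : V → V → Set ℓ
  IsWellOrdering R X = IsRelation R X X × WellOrders (Related R) X

  -- s ∈ I(R), i.e. s = {x ∈ X ∣ x R y} for some y ∈ X
  IsProperInitialSegment : V → V → Pred V ℓ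
  IsProperInitialSegment R X s =
    ∃[ y ] y ∈ X × (∀ x → x ∈ s ⇔ (x ∈ X × Related R x y))

  IsGoodΣ₁WellOrdering : ∀ {n} → Vec V n → V → V → Set ℓ
  IsGoodΣ₁WellOrdering ys R X =
    IsWellOrdering R X × Σ₁-Definable ys (IsProperInitialSegment R X)

  IsOrdinal : Pred V ℓ
  IsOrdinal α = (∀ x → x ∈ α → x ⊆ α) × WellOrders _∈_ α

  _≤_ : Rel V ℓ
  α ≤ β = α ∈ β ⊎ α ≡ β

  IsCardinal : Pred V ℓ
  IsCardinal κ = IsOrdinal κ × (∀ α → α ∈ κ → ¬ Equinumerous α κ)

  -- μ = κ⁺
  IsSuccessorCardinal : V → V → Set ℓ
  IsSuccessorCardinal μ κ =
    IsCardinal μ × κ ∈ μ × (∀ θ → IsCardinal θ → κ ∈ θ → μ ≤ θ)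

  -- μ = κ^θ, the cardinality of the set of all functions from θ to κ
  IsCardinalPower : V → V → V → Set ℓ
  IsCardinalPower μ κ θ =
    IsCardinal μ
    × (∃[ F ] (∀ f → f ∈ F ⇔ IsFunction f θ κ) × Equinumerous F μ)

  IsInaccessibleFor : V → V → Set ℓ
  IsInaccessibleFor δ ν =
    ∀ κ → IsCardinal κ → κ ∈ ν → ∃[ μ ] IsCardinalPower μ κ δ × μ ∈ ν

  HasCofinalMap : V → V → Set ℓ
  HasCofinalMap γ ν =
    ∃[ f ] IsFunction f γ ν
         × (∀ α → α ∈ ν → ∃[ ξ ] ∃[ β ] Related f ξ β × α ≤ β)

  -- γ = cof(ν)
  IsCofinality : V → V → Set ℓ
  IsCofinality γ ν =
    IsOrdinal γ × HasCofinalMap γ ν × (∀ β → β ∈ γ → ¬ HasCofinalMap β ν)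

  record IsUltrafilter (U δ : V) : Set ℓ where
    field
      subsets      : ∀ A → A ∈ U → A ⊆ δ
      whole        : δ ∈ U
      proper       : ∀ A → IsEmpty A → ¬ A ∈ U
      upward       : ∀ A B → A ∈ U → A ⊆ B → B ⊆ δ → B ∈ U
      intersection : ∀ A B C → A ∈ U → B ∈ U →
                     (∀ x → x ∈ C ⇔ (x ∈ A × x ∈ B)) → C ∈ U
      ultra        : ∀ A B → A ⊆ δ → (∀ x → x ∈ B ⇔ (x ∈ δ × ¬ x ∈ A)) →
                     A ∈ U ⊎ B ∈ U

  IsNonprincipal : V → V → Set ℓ
  IsNonprincipal U δ =
    ¬ (∃[ a ] a ∈ δ × (∀ A → A ∈ U ⇔ (A ⊆ δ × a ∈ A)))

  -- U is closed under intersections ⋂_{ξ<γ} f(ξ) for all γ < δ; the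
  -- intersection is taken within δ, so that it equals δ when γ = 0.
  IsComplete : V → V → Set ℓ
  IsComplete U δ =
    ∀ γ f C → γ ∈ δ → IsFunction f γ U →
    (∀ x → x ∈ C ⇔ (x ∈ δ × (∀ ξ A → Related f ξ A → x ∈ A))) → C ∈ U

  IsUncountableCardinal : Pred V ℓ
  IsUncountableCardinal κ = IsCardinal κ × (∃[ w ] IsOmega w × w ∈ κ)

  IsMeasurable : Pred V ℓ
  IsMeasurable δ =
    IsUncountableCardinal δ
    × (∃[ U ] IsUltrafilter U δ × IsNonprincipal U δ × IsComplete U δ)

module Submission where

-- Let M be the ultrapower of V by a δ-complete nonprincipal ultrafilter U on δ
-- and j : V → M the embedding. The hypotheses on ν give j κ = κ. If ◁ is a good
-- Σ₁(κ)-wellordering of P(κ) and S a is its initial segment below a, then j (S a)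
-- satisfies the same Σ₁ formula with parameter j κ = κ, so it is a proper initial
-- segment of ◁, say S (u a). The map u preserves ◁, hence a ⊴ u a. If a ◁ b then
-- a ⊴ u a ◁ u b, so a ∈ j (S b) ⊆ M: all elements of P(κ) except perhaps the last
-- lie in M. But neither {j α ∣ α < κ} nor its complement in κ is in M.
--
-- The collapse of the ultrapower is defined on all functions on δ at once, so that
-- j is a class function and no bound on the Σ₁ witnesses is needed.

open import Defs
open import Axiom.ExcludedMiddle using (ExcludedMiddle)
open import Data.Empty using (⊥; ⊥-elim)
open import Data.Fin.Base using (Fin; zero; suc; _↑ˡ_; _↑ʳ_; splitAt; lift)
open import Data.Nat.Base using (ℕ; zero; suc; _+_)
open import Data.Product using (∃; ∃-syntax; ∃!; _×_; _,_; proj₁; proj₂)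
open import Data.Sum.Base as Sum using (_⊎_; inj₁; inj₂; [_,_]′)
open import Data.Unit.Polymorphic.Base using (⊤; tt)
open import Data.Vec.Base using (Vec; []; _∷_; _++_; lookup; map)
open import Data.Vec.Properties using (lookup-++ˡ; lookup-++ʳ; lookup-splitAt; lookup-map; map-∘; map-cong; map-id)
open import Data.Product.Function.NonDependent.Propositional using (_×-⇔_)
open import Data.Sum.Function.Propositional using (_⊎-⇔_)
open import Function.Base using (_∘_; id)
open import Function.Bundles using (_⇔_; mk⇔; Equivalence)
open import Function.Construct.Composition using (_⇔-∘_)
open import Function.Construct.Identity using (⇔-id)
open import Function.Construct.Symmetry using (⇔-sym)
open import Function.Related.TypeIsomorphisms using (→-cong-⇔; ¬-cong-⇔)
open import Relation.Binary.PropositionalEquality using (_≡_; refl; sym; trans; cong; cong₂; subst)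
open import Relation.Nullary using (¬_; yes; no)
open import Relation.Nullary.Decidable.Core using (recompute)

-- Separation and replacement are schemes over coded formulas, so each predicate used with them
-- needs a code; the opening machinery leaves finding it to instance search. `M` is never formed as
-- a class. Łoś's theorem is proved for Δ₀ formulas with truth on the collapsed sets evaluated in V,
-- which absorbs absoluteness, and `j` carries Σ₁ witnesses along. Why `j` fixes `ν`: as the
-- cofinality of `ν` is not `δ`, completeness bounds every function from `δ` to `ν` almost
-- everywhere by some `a ∈ ν`, and inaccessibility leaves fewer than `ν` functions into `a`, too few
-- for the collapse of the function to reach `ν`. For `ν⁺`, injections of smaller ordinals into `ν`
-- are applied coordinatewise, which reduces the claim to `j ν ≡ ν`. Two sets outside `M` are needed
-- at the end because the last element of the wellordering, if there is one, may escape `M`. A set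
-- and its complement in `κ` are such a pair, since `M` is closed under complements in `κ` once
-- `j κ ≡ κ`.

module Proof {ℓ} (em : ExcludedMiddle ℓ) (𝓥 : Structure ℓ) (zfc : SetTheory.ZFC 𝓥) where

  -- Definability

  open SetTheory 𝓥 public
  open ZFC zfc public
  open Equivalence public using (to; from)

  rename : ∀ {m n} → (Fin m → Fin n) → Formula m → Formula n
  rename f (i ∈̇ j) = f i ∈̇ f j
  rename f (i ≡̇ j) = f i ≡̇ f j
  rename f (¬̇ φ)   = ¬̇ rename f φ
  rename f (φ ∧̇ ψ) = rename f φ ∧̇ rename f ψ
  rename f (φ ∨̇ ψ) = rename f φ ∨̇ rename f ψ
  rename f (φ ⇒̇ ψ) = rename f φ ⇒̇ rename f ψ
  rename f (∀̇ φ)   = ∀̇ rename (lift 1 f) φ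
  rename f (∃̇ φ)   = ∃̇ rename (lift 1 f) φ

  ∃-cong : ∀ {a} {P Q : V → Set a} → (∀ x → P x ⇔ Q x) → ∃ P ⇔ ∃ Q
  ∃-cong e = mk⇔ (λ (x , p) → x , to (e x) p) (λ (x , q) → x , from (e x) q)

  ∀-cong : ∀ {a} {P Q : V → Set a} → (∀ x → P x ⇔ Q x) → (∀ x → P x) ⇔ (∀ x → Q x)
  ∀-cong e = mk⇔ (λ p x → to (e x) (p x)) (λ q x → from (e x) (q x))

  ≡⇒⇔ : ∀ {a} {P Q : Set a} → P ≡ Q → P ⇔ Q
  ≡⇒⇔ refl = ⇔-id _

  Sat-rename : ∀ {m n} (f : Fin m → Fin n) φ {ρ : Vec V m} {σ : Vec V n} →
               (∀ i → lookup σ (f i) ≡ lookup ρ i) → Sat φ ρ ⇔ Sat (rename f φ) σ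
  Sat-rename f (i ∈̇ j) e = ≡⇒⇔ (sym (cong₂ _∈_ (e i) (e j)))
  Sat-rename f (i ≡̇ j) e = ≡⇒⇔ (sym (cong₂ _≡_ (e i) (e j)))
  Sat-rename f (¬̇ φ)   e = ¬-cong-⇔ (Sat-rename f φ e)
  Sat-rename f (φ ∧̇ ψ) e = Sat-rename f φ e ×-⇔ Sat-rename f ψ e
  Sat-rename f (φ ∨̇ ψ) e = Sat-rename f φ e ⊎-⇔ Sat-rename f ψ e
  Sat-rename f (φ ⇒̇ ψ) e = →-cong-⇔ (Sat-rename f φ e) (Sat-rename f ψ e)
  Sat-rename f (∀̇ φ)   e = ∀-cong λ x → Sat-rename (lift 1 f) φ λ { zero → refl ; (suc i) → e i }
  Sat-rename f (∃̇ φ)   e = ∃-cong λ x → Sat-rename (lift 1 f) φ λ { zero → refl ; (suc i) → e i }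

  -- A context of n elements, nested so that η for pairs lets Agda infer the
  -- predicate under a quantifier by pattern unification.
  Env : ℕ → Set ℓ
  Env zero    = ⊤
  Env (suc n) = V × Env n

  toVec : ∀ {n} → Env n → Vec V n
  toVec {zero}  _       = []
  toVec {suc n} (x , ρ) = x ∷ toVec ρ

  -- `params` holds the sets captured from the surrounding proof, so that constants do not lengthen
  -- the context.
  record Def {n} (P : Env n → Set ℓ) : Set ℓ where
    constructor def
    field
      {size}  : ℕ
      params  : Vec V size
      code    : Formula (n + size)
      correct : ∀ ρ → P ρ ⇔ Sat code (toVec ρ ++ params)

  -- The language has no function symbols, so an operation counts as definable when its graph is.
  record DefTerm {n} (t : Env n → V) : Set ℓ where
    constructor defTerm
    field graph : Def {suc n} (λ ρ → proj₁ ρ ≡ t (proj₂ ρ))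

  -- Instance arguments are irrelevant so that overlapping candidates are
  -- harmless; excluded middle recovers the formula.
  relevant : {A : Set ℓ} → .A → A
  relevant = recompute em

  module _ {n : ℕ} where opaque

    reindex : ∀ {k} {P : Env n → Set ℓ} (g : Env k → Env n) (f : Fin n → Fin k) →
              (∀ ρ i → lookup (toVec ρ) (f i) ≡ lookup (toVec (g ρ)) i) → Def P → Def (P ∘ g)
    reindex {k} g f e (def {m} ps φ c) = def ps (rename r φ) λ ρ → Sat-rename r φ (ok ρ) ⇔-∘ c (g ρ)
      where
      r : Fin (n + m) → Fin (k + m)
      r i = [ (λ j → f j ↑ˡ m) , (k ↑ʳ_) ]′ (splitAt n i)
      ok : ∀ ρ i → lookup (toVec ρ ++ ps) (r i) ≡ lookup (toVec (g ρ) ++ ps) i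
      ok ρ i rewrite lookup-splitAt n (toVec (g ρ)) ps i with splitAt n i
      ... | inj₁ j = trans (lookup-++ˡ (toVec ρ) ps (f j)) (e ρ j)
      ... | inj₂ j = lookup-++ʳ (toVec ρ) ps j

    cast : {P Q : Env n → Set ℓ} → (∀ ρ → Q ρ ⇔ P ρ) → Def P → Def Q
    cast e (def ps φ c) = def ps φ λ ρ → c ρ ⇔-∘ e ρ

    -- A connective needs both of its formulas over one parameter list. `padˡ` and `padʳ` move them
    -- to the concatenation of their lists.
    padˡ : ∀ {m} k → Formula (n + m) → Formula (n + (m + k))
    padˡ {m} k = rename ([ _↑ˡ (m + k) , (λ j → n ↑ʳ (j ↑ˡ k)) ]′ ∘ splitAt n)

    padˡ-correct : ∀ {m k} (φ : Formula (n + m)) (xs : Vec V n) ps (qs : Vec V k) →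
                   Sat φ (xs ++ ps) ⇔ Sat (padˡ k φ) (xs ++ (ps ++ qs))
    padˡ-correct φ xs ps qs = Sat-rename _ φ ok where
      ok : ∀ i → lookup (xs ++ (ps ++ qs)) ([ _↑ˡ _ , (λ j → n ↑ʳ (j ↑ˡ _)) ]′ (splitAt n i)) ≡ lookup (xs ++ ps) i
      ok i rewrite lookup-splitAt n xs ps i with splitAt n i
      ... | inj₁ j = lookup-++ˡ xs (ps ++ qs) j
      ... | inj₂ j = trans (lookup-++ʳ xs (ps ++ qs) _) (lookup-++ˡ ps qs j)

    padʳ : ∀ m {k} → Formula (n + k) → Formula (n + (m + k))
    padʳ m {k} = rename ([ _↑ˡ (m + k) , (λ j → n ↑ʳ (m ↑ʳ j)) ]′ ∘ splitAt n)

    padʳ-correct : ∀ {m k} (φ : Formula (n + k)) (xs : Vec V n) (ps : Vec V m) qs →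
                   Sat φ (xs ++ qs) ⇔ Sat (padʳ m φ) (xs ++ (ps ++ qs))
    padʳ-correct φ xs ps qs = Sat-rename _ φ ok where
      ok : ∀ i → lookup (xs ++ (ps ++ qs)) ([ _↑ˡ _ , (λ j → n ↑ʳ (_ ↑ʳ j)) ]′ (splitAt n i)) ≡ lookup (xs ++ qs) i
      ok i rewrite lookup-splitAt n xs qs i with splitAt n i
      ... | inj₁ j = lookup-++ˡ xs (ps ++ qs) j
      ... | inj₂ j = trans (lookup-++ʳ xs (ps ++ qs) _) (lookup-++ʳ ps qs j)

    both : {P Q R : Env n → Set ℓ} (op : ∀ {k} → Formula k → Formula k → Formula k) →
           (∀ {k} {φ ψ : Formula (n + k)} {σ} ρ → P ρ ⇔ Sat φ σ → Q ρ ⇔ Sat ψ σ → R ρ ⇔ Sat (op φ ψ) σ) →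
           .(Def P) → .(Def Q) → Def R
    both op ok d₁ d₂ with relevant d₁ | relevant d₂
    ... | def ps φ c | def qs ψ d =
      def (ps ++ qs) (op (padˡ _ φ) (padʳ _ ψ)) λ ρ →
        ok ρ (padˡ-correct φ (toVec ρ) ps qs ⇔-∘ c ρ) (padʳ-correct ψ (toVec ρ) ps qs ⇔-∘ d ρ)

  opaque
    weakenTerm : ∀ {n} {t : Env n → V} → DefTerm t → DefTerm {suc n} (t ∘ proj₂)
    weakenTerm {n} (defTerm d) = defTerm (reindex {suc n} {suc (suc n)} (λ (y , x , ρ) → y , ρ) (lift 1 suc)
      (λ { _ zero → refl ; _ (suc i) → refl }) d)

  module _ {n : ℕ} where

    private variable
      P Q : Env n → Set ℓ

    defBoth : .(Def P) → .(Def Q) → Def (λ ρ → P ρ × Q ρ)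
    defBoth = both _∧̇_ (λ _ → _×-⇔_)

    defImplies : .(Def P) → .(Def Q) → Def (λ ρ → P ρ → Q ρ)
    defImplies = both _⇒̇_ (λ _ → →-cong-⇔)

    instance opaque
      def∨ : .⦃ Def P ⦄ → .⦃ Def Q ⦄ → Def (λ ρ → P ρ ⊎ Q ρ)
      def∨ ⦃ p ⦄ ⦃ q ⦄ = both _∨̇_ (λ _ → _⊎-⇔_) p q

      def⇔ : .⦃ Def P ⦄ → .⦃ Def Q ⦄ → Def (λ ρ → P ρ ⇔ Q ρ)
      def⇔ ⦃ p ⦄ ⦃ q ⦄ = both (λ φ ψ → (φ ⇒̇ ψ) ∧̇ (ψ ⇒̇ φ)) (λ _ e f → mk⇔
        (λ h → (to f ∘ to h ∘ from e) , (to e ∘ from h ∘ from f))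
        (λ (h , k) → mk⇔ (from f ∘ h ∘ to e) (from e ∘ k ∘ to f))) p q

      def¬ : .⦃ Def P ⦄ → Def (λ ρ → ¬ P ρ)
      def¬ ⦃ p ⦄ with relevant p
      ... | def ps φ c = def ps (¬̇ φ) (¬-cong-⇔ ∘ c)

      def∀ : {P : Env (suc n) → Set ℓ} → .⦃ Def P ⦄ → Def (λ ρ → ∀ x → P (x , ρ))
      def∀ ⦃ p ⦄ with relevant p
      ... | def ps φ c = def ps (∀̇ φ) λ ρ → ∀-cong λ x → c (x , ρ)

      def∃ : {P : Env (suc n) → Set ℓ} → .⦃ Def P ⦄ → Def (λ ρ → ∃ λ x → P (x , ρ))
      def∃ ⦃ p ⦄ with relevant p
      ... | def ps φ c = def ps (∃̇ φ) λ ρ → ∃-cong λ x → c (x , ρ)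

  opaque
    -- Without terms in the language, `P (t ρ)` is coded as the existence of a `y` on the graph of
    -- `t` that satisfies `P`.
    substitute : ∀ {n} {t : Env n → V} {P : Env (suc n) → Set ℓ} →
                 DefTerm t → Def P → Def (λ ρ → P (t ρ , ρ))
    substitute {P = P} (defTerm d) p = cast
      (λ ρ → mk⇔ (λ h → _ , refl , h) (λ { (_ , refl , h) → h }))
      (def∃ ⦃ defBoth d p ⦄)

  module _ {n : ℕ} where opaque

    -- Lifts definability from two bare variables to arbitrary terms. The local instances for
    -- abstract relations (`dK`, `defE` and the like) are obtained in this way.
    defRel : {R : V → V → Set ℓ} → .(Def {2} λ ρ → R (proj₁ ρ) (proj₁ (proj₂ ρ))) →
             {s t : Env n → V} → .(DefTerm s) → .(DefTerm t) → Def (λ ρ → R (s ρ) (t ρ))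
    defRel d s t = substitute (relevant s) (substitute (weakenTerm (relevant t))
      (reindex {2} {2 + n} (λ (y , x , _) → x , y , tt) (λ { zero → suc zero ; (suc i) → zero })
        (λ { _ zero → refl ; _ (suc zero) → refl }) (relevant d)))

    defPred : {P : V → Set ℓ} → .(Def {1} λ ρ → P (proj₁ ρ)) →
              {t : Env n → V} → .(DefTerm t) → Def (λ ρ → P (t ρ))
    defPred d t = substitute (relevant t)
      (reindex {1} {suc n} (λ (x , _) → x , tt) (λ { zero → zero }) (λ { _ zero → refl }) (relevant d))

    defFun₁ : {h : V → V} → .(DefTerm {1} λ ρ → h (proj₁ ρ)) →
              {s : Env n → V} → .(DefTerm s) → DefTerm (λ ρ → h (s ρ))
    defFun₁ {h} d s = defTerm (substitute (weakenTerm (relevant s))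
      (reindex {2} {2 + n} (λ (a , y , _) → y , a , tt) (λ { zero → suc zero ; (suc i) → zero })
        (λ { _ zero → refl ; _ (suc zero) → refl }) (DefTerm.graph (relevant d))))

    defFun₂ : {h : V → V → V} → .(DefTerm {2} λ ρ → h (proj₁ ρ) (proj₁ (proj₂ ρ))) →
              {s t : Env n → V} → .(DefTerm s) → .(DefTerm t) → DefTerm (λ ρ → h (s ρ) (t ρ))
    defFun₂ {h} d s t = defTerm (substitute (weakenTerm (relevant s))
      (substitute (weakenTerm (weakenTerm (relevant t)))
      (reindex {3} {3 + n} (λ (b , a , y , _) → y , a , b , tt)
        (λ { zero → suc (suc zero) ; (suc zero) → suc zero ; (suc (suc i)) → zero })
        (λ { _ zero → refl ; _ (suc zero) → refl ; _ (suc (suc zero)) → refl }) (DefTerm.graph (relevant d)))))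

    instance opaque
      def∈ : {s t : Env n → V} → .⦃ DefTerm s ⦄ → .⦃ DefTerm t ⦄ → Def (λ ρ → s ρ ∈ t ρ)
      def∈ ⦃ s ⦄ ⦃ t ⦄ = defRel (def [] (zero ∈̇ suc zero) λ _ → ⇔-id _) s t

      def≡ : {s t : Env n → V} → .⦃ DefTerm s ⦄ → .⦃ DefTerm t ⦄ → Def (λ ρ → s ρ ≡ t ρ)
      def≡ ⦃ s ⦄ ⦃ t ⦄ = defRel (def [] (zero ≡̇ suc zero) λ _ → ⇔-id _) s t

    instance opaque
      var0 : DefTerm {1 + n} λ ρ → proj₁ ρ
      var0 = defTerm (def [] (zero ≡̇ suc zero) λ _ → ⇔-id _)

  module _ {n : ℕ} where
    instance opaque
      var1 : DefTerm {2 + n} λ ρ → proj₁ (proj₂ ρ)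
      var1 = weakenTerm var0

      var2 : DefTerm {3 + n} λ ρ → proj₁ (proj₂ (proj₂ ρ))
      var2 = weakenTerm var1

      var3 : DefTerm {4 + n} λ ρ → proj₁ (proj₂ (proj₂ (proj₂ ρ)))
      var3 = weakenTerm var2

      var4 : DefTerm {5 + n} λ ρ → proj₁ (proj₂ (proj₂ (proj₂ (proj₂ ρ))))
      var4 = weakenTerm var3

      var5 : DefTerm {6 + n} λ ρ → proj₁ (proj₂ (proj₂ (proj₂ (proj₂ (proj₂ ρ)))))
      var5 = weakenTerm var4

  -- In irrelevant position Agda takes the oldest matching instance. The
  -- instances below also match goals meant for def∃, def∀ or a compound term,
  -- so each section makes a fresh copy of them after its own instances.
  module Fallback (_ : ⊤ {ℓ}) {n : ℕ} where
    instance opaque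
      def∧ : {P Q : Env n → Set ℓ} → .⦃ Def P ⦄ → .⦃ Def Q ⦄ → Def (λ ρ → P ρ × Q ρ)
      def∧ ⦃ p ⦄ ⦃ q ⦄ = defBoth p q

      def⇒ : {P Q : Env n → Set ℓ} → .⦃ Def P ⦄ → .⦃ Def Q ⦄ → Def (λ ρ → P ρ → Q ρ)
      def⇒ ⦃ p ⦄ ⦃ q ⦄ = defImplies p q

      defConst : ∀ {c} → DefTerm {n} (λ _ → c)
      defConst {c} = defTerm (def (c ∷ []) (zero ≡̇ suc (n ↑ʳ zero)) λ (x , ρ) →
        ≡⇒⇔ (cong (x ≡_) (sym (lookup-++ʳ (toVec ρ) (c ∷ []) zero))))

  -- Comprehension terms and ordered pairs

  decide : (A : Set ℓ) → A ⊎ ¬ A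
  decide A with em {A}
  ... | yes a = inj₁ a
  ... | no ¬a = inj₂ ¬a

  byContradiction : {A : Set ℓ} → ¬ ¬ A → A
  byContradiction {A} h with em {A}
  ... | yes a = a
  ... | no ¬a = ⊥-elim (h ¬a)

  IsSet : (V → Set ℓ) → Set ℓ
  IsSet P = ∃ λ b → ∀ x → x ∈ b ⇔ P x

  opaque
    -- {x ∣ P x}, and an unspecified set if that class is proper
    setOf : (V → Set ℓ) → V
    setOf P with em {IsSet P}
    ... | yes (b , _) = b
    ... | no _        = proj₁ infinity

    ∈setOf : ∀ {P} → IsSet P → ∀ {x} → x ∈ setOf P ⇔ P x
    ∈setOf {P} s {x} with em {IsSet P}
    ... | yes (_ , h) = h x
    ... | no ¬s       = ⊥-elim (¬s s)

    -- The case distinction in `setOf` is itself first-order, so comprehension terms are definable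
    -- before it is known that the class is a set.
    setOf-graph : ∀ P y → y ≡ setOf P ⇔ ((∀ z → z ∈ y ⇔ P z) ⊎ (¬ IsSet P × y ≡ proj₁ infinity))
    setOf-graph P y with em {IsSet P}
    ... | yes (b , h) = mk⇔ (λ { refl → inj₁ h })
      λ { (inj₁ k) → extensionality y b λ z → ⇔-sym (h z) ⇔-∘ k z ; (inj₂ (¬s , _)) → ⊥-elim (¬s (b , h)) }
    ... | no ¬s = mk⇔ (λ e → inj₂ (¬s , e)) λ { (inj₁ k) → ⊥-elim (¬s (y , k)) ; (inj₂ (_ , e)) → e }

  module _ {n : ℕ} where
    instance opaque
      defSetOf : {P : Env (suc n) → Set ℓ} → .⦃ Def P ⦄ → DefTerm (λ ρ → setOf λ z → P (z , ρ))
      defSetOf {P} ⦃ p ⦄ = defTerm (cast (λ (y , ρ) → setOf-graph (λ z → P (z , ρ)) y)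
        (def∨ ⦃ def∀ ⦃ def⇔ ⦃ it₁ ⦄ ⦃ p₁ ⦄ ⦄ ⦄ ⦃ defBoth (def¬ ⦃ def∃ ⦃ def∀ ⦃ def⇔ ⦃ it₁ ⦄ ⦃ p₂ ⦄ ⦄ ⦄ ⦄) (def≡ ⦃ var0 ⦄ ⦃ weakenTerm const ⦄) ⦄))
        where
        it₁ : ∀ {m} → Def {2 + m} λ ρ → proj₁ ρ ∈ proj₁ (proj₂ ρ)
        it₁ = def∈
        const : DefTerm {n} (λ _ → proj₁ infinity)
        const = F.defConst where module F = Fallback tt
        p₁ : Def {2 + n} λ (z , y , ρ) → P (z , ρ)
        p₁ = reindex {suc n} {2 + n} (λ (z , y , ρ) → z , ρ) (lift 1 suc) (λ { _ zero → refl ; _ (suc i) → refl }) (relevant p)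
        p₂ : Def {3 + n} λ (z , b , y , ρ) → P (z , ρ)
        p₂ = reindex {suc n} {3 + n} (λ (z , b , y , ρ) → z , ρ) (lift 1 λ i → suc (suc i)) (λ { _ zero → refl ; _ (suc i) → refl }) (relevant p)

  ext : ∀ {x y} → x ⊆ y → y ⊆ x → x ≡ y
  ext {x} {y} p q = extensionality x y λ z → mk⇔ (p z) (q z)

  module _ {P : V → Set ℓ} .⦃ p : Def {1} (λ ρ → P (proj₁ ρ)) ⦄ where opaque

    sep-set : ∀ a → IsSet (λ x → x ∈ a × P x)
    sep-set a with relevant p
    ... | def ps φ c with separation φ ps a
    ... | b , h = b , λ x → (⇔-id _ ×-⇔ ⇔-sym (c (x , tt))) ⇔-∘ h x

    bounded-set : ∀ a → (∀ x → P x → x ∈ a) → IsSet P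
    bounded-set a h with sep-set a
    ... | b , e = b , λ x → mk⇔ (proj₂ ∘ to (e x)) (λ q → from (e x) (h x q , q))

  opaque
    img-set : {t : V → V} → .⦃ DefTerm {1} (λ ρ → t (proj₁ ρ)) ⦄ → ∀ a → IsSet (λ y → ∃ λ x → x ∈ a × y ≡ t x)
    img-set {t} ⦃ d ⦄ a with reindex {2} {2} (λ (x , y , _) → y , x , tt) (λ { zero → suc zero ; (suc i) → zero })
      (λ { _ zero → refl ; _ (suc zero) → refl }) (DefTerm.graph (relevant d))
    ... | def ps φ c with replacement φ ps a
      (λ x _ y y′ s s′ → trans (from (c (x , y , tt)) s) (sym (from (c (x , y′ , tt)) s′)))
    ... | b , h = b , λ y → ∃-cong (λ x → ⇔-id _ ×-⇔ ⇔-sym (c (x , y , tt))) ⇔-∘ h y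

  sep : V → (V → Set ℓ) → V
  sep a P = setOf λ x → x ∈ a × P x

  img : V → (V → V) → V
  img a t = setOf λ y → ∃ λ x → x ∈ a × y ≡ t x

  pair : V → V → V
  pair x y = setOf λ z → z ≡ x ⊎ z ≡ y

  ⋃ : V → V
  ⋃ x = setOf λ z → ∃ λ y → y ∈ x × z ∈ y

  𝒫 : V → V
  𝒫 x = setOf λ z → z ⊆ x

  infixr 6 _∪_
  _∪_ : V → V → V
  a ∪ b = setOf λ z → z ∈ a ⊎ z ∈ b

  succ : V → V
  succ x = setOf λ z → z ∈ x ⊎ z ≡ x

  ∅ : V
  ∅ = setOf λ x → ¬ x ≡ x

  opaque
    ∈sep : ∀ {P a x} → .⦃ Def {1} (λ ρ → P (proj₁ ρ)) ⦄ → x ∈ sep a P ⇔ (x ∈ a × P x)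
    ∈sep {a = a} = ∈setOf (sep-set a)

    ∈img : ∀ {t a y} → .⦃ DefTerm {1} (λ ρ → t (proj₁ ρ)) ⦄ → y ∈ img a t ⇔ ∃ λ x → x ∈ a × y ≡ t x
    ∈img {a = a} = ∈setOf (img-set a)

    ∈pair : ∀ {x y z} → z ∈ pair x y ⇔ (z ≡ x ⊎ z ≡ y)
    ∈pair = ∈setOf (pairing _ _)

    ∈⋃ : ∀ {x z} → z ∈ ⋃ x ⇔ ∃ λ y → y ∈ x × z ∈ y
    ∈⋃ = ∈setOf (union _)

    ∈𝒫 : ∀ {x z} → z ∈ 𝒫 x ⇔ z ⊆ x
    ∈𝒫 = ∈setOf (powerSet _)

  module _ where
    private module F = Fallback tt
    opaque

      ∉∅ : ∀ {x} → ¬ x ∈ ∅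
      ∉∅ x∈ = to (∈setOf (bounded-set (proj₁ infinity) λ x h → ⊥-elim (h refl))) x∈ refl

      ∈∪ : ∀ {a b z} → z ∈ a ∪ b ⇔ (z ∈ a ⊎ z ∈ b)
      ∈∪ {a} {b} = ∈setOf (bounded-set (⋃ (pair a b))
        λ { _ (inj₁ h) → from ∈⋃ (_ , from ∈pair (inj₁ refl) , h)
          ; _ (inj₂ h) → from ∈⋃ (_ , from ∈pair (inj₂ refl) , h) })

      ∈succ : ∀ {x z} → z ∈ succ x ⇔ (z ∈ x ⊎ z ≡ x)
      ∈succ {x} = ∈setOf (bounded-set (x ∪ pair x x)
        λ { _ (inj₁ h) → from ∈∪ (inj₁ h) ; _ (inj₂ h) → from ∈∪ (inj₂ (from ∈pair (inj₁ h))) })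

  empty : ∀ {x} → (∀ z → ¬ z ∈ x) → x ≡ ∅
  empty h = ext (λ z z∈ → ⊥-elim (h z z∈)) (λ z z∈ → ⊥-elim (∉∅ z∈))

  opaque
    ⟨_,_⟩ : V → V → V
    ⟨ x , y ⟩ = pair (pair x x) (pair x y)

    isOrderedPair : ∀ {p x y} → IsOrderedPair p x y ⇔ p ≡ ⟨ x , y ⟩
    isOrderedPair {p} {x} {y} = mk⇔
      (λ h → ext (λ z z∈ → from ∈pair (Sum.map isPair isPair (to (h z) z∈)))
                 (λ z z∈ → from (h z) (Sum.map pairIs pairIs (to ∈pair z∈))))
      λ { refl z → mk⇔ (λ z∈ → Sum.map pairIs pairIs (to ∈pair z∈))
                       (λ z∈ → from ∈pair (Sum.map isPair isPair z∈)) }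
      where
      isPair : ∀ {p x y} → IsPair p x y → p ≡ pair x y
      isPair h = ext (λ z → from ∈pair ∘ to (h z)) (λ z → from (h z) ∘ to ∈pair)
      pairIs : ∀ {p x y} → p ≡ pair x y → IsPair p x y
      pairIs refl z = ∈pair

    ⟨⟩-injective : ∀ {x y x′ y′} → ⟨ x , y ⟩ ≡ ⟨ x′ , y′ ⟩ → x ≡ x′ × y ≡ y′
    ⟨⟩-injective {x} {y} {x′} {y′} e = x≡x′ , y≡y′
      where
      singleton : ∀ {a b c} → pair a a ≡ pair b c → a ≡ b × a ≡ c
      singleton {a} {b} {c} e = f (inj₁ refl) , f (inj₂ refl) where
        f : ∀ {d} → d ≡ b ⊎ d ≡ c → a ≡ d
        f {d} h with to ∈pair (subst (d ∈_) (sym e) (from ∈pair h))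
        ... | inj₁ refl = refl
        ... | inj₂ refl = refl
      x≡x′ : x ≡ x′
      x≡x′ with to ∈pair (subst (pair x x ∈_) e (from ∈pair (inj₁ refl)))
      ... | inj₁ h = proj₁ (singleton h)
      ... | inj₂ h = proj₁ (singleton h)
      cancel : ∀ {a b c} → pair a b ≡ pair a c → b ≡ c
      cancel e with to ∈pair (subst (_ ∈_) e (from ∈pair (inj₂ refl)))
      ... | inj₂ b≡c = b≡c
      ... | inj₁ b≡a with to ∈pair (subst (_ ∈_) (sym e) (from ∈pair (inj₂ refl)))
      ...   | inj₁ c≡a = trans b≡a (sym c≡a)
      ...   | inj₂ c≡b = sym c≡b
      y≡y′ : y ≡ y′
      y≡y′ with x≡x′
      ... | refl with to ∈pair (subst (pair x y ∈_) e (from ∈pair (inj₂ refl)))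
                    | to ∈pair (subst (pair x y′ ∈_) (sym e) (from ∈pair (inj₂ refl)))
      ...   | inj₂ h | _      = cancel h
      ...   | inj₁ _ | inj₂ k = sym (cancel k)
      ...   | inj₁ h | inj₁ k = trans (cancel h) (sym (cancel k))

    ∈⟨⟩ : ∀ {x y} → pair x x ∈ ⟨ x , y ⟩ × pair x y ∈ ⟨ x , y ⟩
    ∈⟨⟩ = from ∈pair (inj₁ refl) , from ∈pair (inj₂ refl)

    infixl 8 _·_
    -- If f is not functional at x, this is the union of all its values there.
    _·_ : V → V → V
    f · x = setOf λ z → ∃ λ y → ⟨ x , y ⟩ ∈ f × z ∈ y

  -- Functions and choice

  opaque
    unfolding ⟨_,_⟩

    graph⟨⟩ : DefTerm {2} (λ ρ → ⟨ proj₁ ρ , proj₁ (proj₂ ρ) ⟩)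
    graph⟨⟩ = defSetOf where module F = Fallback tt

  module _ {n : ℕ} {s t : Env n → V} where
    instance opaque
      def⟨,⟩ : .⦃ DefTerm s ⦄ → .⦃ DefTerm t ⦄ → DefTerm (λ ρ → ⟨ s ρ , t ρ ⟩)
      def⟨,⟩ ⦃ s ⦄ ⦃ t ⦄ = defFun₂ graph⟨⟩ s t

  opaque
    unfolding _·_

    ∈· : ∀ {f x z} → z ∈ f · x ⇔ ∃ λ y → ⟨ x , y ⟩ ∈ f × z ∈ y
    ∈· {f} {x} = ∈setOf (bounded-set (⋃ (⋃ (⋃ f))) λ z (y , p , q) →
      from ∈⋃ (y , from ∈⋃ (_ , from ∈⋃ (_ , p , proj₂ ∈⟨⟩) , from ∈pair (inj₂ refl)) , q))
      where module F = Fallback tt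

    graph· : DefTerm {2} (λ ρ → proj₁ ρ · proj₁ (proj₂ ρ))
    graph· = defSetOf where module F = Fallback tt

  module _ {n : ℕ} {s t : Env n → V} where
    instance opaque
      def· : .⦃ DefTerm s ⦄ → .⦃ DefTerm t ⦄ → DefTerm (λ ρ → s ρ · t ρ)
      def· ⦃ s ⦄ ⦃ t ⦄ = defFun₂ graph· s t

  ·-value : ∀ {f x y} → ⟨ x , y ⟩ ∈ f → (∀ y′ → ⟨ x , y′ ⟩ ∈ f → y′ ≡ y) → f · x ≡ y
  ·-value p u = ext
    (λ z z∈ → let y′ , q , h = to ∈· z∈ in subst (z ∈_) (u y′ q) h)
    (λ z z∈ → from ∈· (_ , p , z∈))

  ƛ : V → (V → V) → V
  ƛ a t = img a λ x → ⟨ x , t x ⟩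

  prod : V → V → V
  prod a b = setOf λ p → ∃ λ x → x ∈ a × ∃ λ y → y ∈ b × p ≡ ⟨ x , y ⟩

  -- The equation `f ≡ ƛ a (f ·_)` discards junk: `f` is then exactly its graph on `a` and is
  -- determined by its values.
  funs : V → V → V
  funs a b = sep (𝒫 (prod a b)) λ f → f ≡ ƛ a (f ·_) × (∀ x → x ∈ a → f · x ∈ b)

  ∈-irrefl : ∀ {x} → ¬ x ∈ x
  ∈-irrefl {x} h with foundation (pair x x) (x , from ∈pair (inj₁ refl))
  ... | y , y∈ , m with to ∈pair y∈
  ...   | inj₁ refl = m x h (from ∈pair (inj₁ refl))
  ...   | inj₂ refl = m x h (from ∈pair (inj₁ refl))

  ∈-asym : ∀ {x y} → x ∈ y → ¬ y ∈ x
  ∈-asym {x} {y} h k with foundation (pair x y) (x , from ∈pair (inj₁ refl))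
  ... | z , z∈ , m with to ∈pair z∈
  ...   | inj₁ refl = m y k (from ∈pair (inj₂ refl))
  ...   | inj₂ refl = m x h (from ∈pair (inj₁ refl))

  related : ∀ {f x y} → Related f x y ⇔ ⟨ x , y ⟩ ∈ f
  related = mk⇔ (λ (p , o , p∈) → subst (_∈ _) (to isOrderedPair o) p∈) (λ p∈ → _ , from isOrderedPair refl , p∈)

  module _ {t : V → V} .⦃ d : DefTerm {1} (λ ρ → t (proj₁ ρ)) ⦄ where
    private instance
      dt : ∀ {n} {s : Env n → V} → .⦃ DefTerm s ⦄ → DefTerm (λ ρ → t (s ρ))
      dt ⦃ s ⦄ = defFun₁ d s
    private module F = Fallback tt
    opaque

      ∈ƛ : ∀ {a p} → p ∈ ƛ a t ⇔ ∃ λ x → x ∈ a × p ≡ ⟨ x , t x ⟩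
      ∈ƛ = ∈img

      ⟨⟩∈ƛ : ∀ {a x y} → ⟨ x , y ⟩ ∈ ƛ a t ⇔ (x ∈ a × y ≡ t x)
      ⟨⟩∈ƛ {a} {x} {y} = mk⇔ f λ { (x∈ , refl) → from ∈ƛ (x , x∈ , refl) }
        where
        f : ⟨ x , y ⟩ ∈ ƛ a t → x ∈ a × y ≡ t x
        f h with to ∈ƛ h
        ... | x′ , x∈ , e with ⟨⟩-injective e
        ...   | refl , e′ = x∈ , e′

      ƛ-· : ∀ {a x} → x ∈ a → ƛ a t · x ≡ t x
      ƛ-· x∈ = ·-value (from ⟨⟩∈ƛ (x∈ , refl)) λ y h → proj₂ (to ⟨⟩∈ƛ h)

      ƛ-cong : ∀ {a} {s : V → V} → .⦃ DefTerm {1} (λ ρ → s (proj₁ ρ)) ⦄ → (∀ x → x ∈ a → s x ≡ t x) → ƛ a s ≡ ƛ a t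
      ƛ-cong e = ext
        (λ p h → let x , x∈ , q = to ∈img h in from ∈ƛ (x , x∈ , trans q (cong ⟨ x ,_⟩ (e x x∈))))
        (λ p h → let x , x∈ , q = to ∈ƛ h in from ∈img (x , x∈ , trans q (cong ⟨ x ,_⟩ (sym (e x x∈)))))

      ƛ-canonical : ∀ {a} → ƛ a t ≡ ƛ a (ƛ a t ·_)
      ƛ-canonical = sym (ƛ-cong λ x → ƛ-·)

      ƛ-isFunction : ∀ {a b} → (∀ x → x ∈ a → t x ∈ b) → IsFunction (ƛ a t) a b
      ƛ-isFunction h =
        (λ p p∈ → let x , x∈ , e = to ∈ƛ p∈ in x , t x , x∈ , h x x∈ , from isOrderedPair e) ,
        λ x x∈ → t x , from related (from ⟨⟩∈ƛ (x∈ , refl)) , λ r → sym (proj₂ (to ⟨⟩∈ƛ (to related r)))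

  module _ where
    private module F = Fallback tt
    opaque

      ∈prod : ∀ {a b p} → p ∈ prod a b ⇔ ∃ λ x → x ∈ a × ∃ λ y → y ∈ b × p ≡ ⟨ x , y ⟩
      ∈prod {a} {b} = ∈setOf (bounded-set (⋃ (img a λ x → img b λ y → ⟨ x , y ⟩))
        λ p (x , x∈ , y , y∈ , e) → from ∈⋃ (_ , from ∈img (x , x∈ , refl) , from ∈img (y , y∈ , e)))

      ⟨⟩∈prod : ∀ {a b x y} → ⟨ x , y ⟩ ∈ prod a b ⇔ (x ∈ a × y ∈ b)
      ⟨⟩∈prod {a} {b} {x} {y} = mk⇔ f λ (x∈ , y∈) → from ∈prod (x , x∈ , y , y∈ , refl)
        where
        f : ⟨ x , y ⟩ ∈ prod a b → x ∈ a × y ∈ b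
        f h with to ∈prod h
        ... | _ , x∈ , _ , y∈ , e with ⟨⟩-injective e
        ...   | refl , refl = x∈ , y∈

      isFunction-apply : ∀ {f a b x} → IsFunction f a b → x ∈ a → f · x ∈ b × ⟨ x , f · x ⟩ ∈ f
      isFunction-apply {f} {a} {b} {x} (r , t) x∈ with t x x∈
      ... | y , q , u with ·-value (to related q) (λ y′ h → sym (u (from related h))) | r _ (to related q)
      ...   | refl | x′ , y′ , _ , y∈ , o with ⟨⟩-injective (to isOrderedPair o)
      ...     | refl , refl = y∈ , to related q

      isFunction-graph : ∀ {f a b x y} → IsFunction f a b → ⟨ x , y ⟩ ∈ f → x ∈ a × y ≡ f · x
      isFunction-graph (r , t) p with r _ p
      ... | x′ , y′ , x∈ , _ , o with ⟨⟩-injective (to isOrderedPair o)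
      ...   | refl , refl with t x′ x∈
      ...     | z , q , u = x∈ , sym (·-value p λ y″ h → trans (sym (u (from related h))) (u (from related p)))

      canonical-isFunction : ∀ {f a b} → f ≡ ƛ a (f ·_) → (∀ x → x ∈ a → f · x ∈ b) → IsFunction f a b
      canonical-isFunction e h = subst (λ g → IsFunction g _ _) (sym e) (ƛ-isFunction h)

      ∈funs : ∀ {a b f} → f ∈ funs a b ⇔ (f ≡ ƛ a (f ·_) × (∀ x → x ∈ a → f · x ∈ b))
      ∈funs {a} {b} {f} = mk⇔ (proj₂ ∘ to ∈sep) λ (e , h) → from ∈sep
        (from ∈𝒫 (λ p p∈ → let x , x∈ , q = to ∈ƛ (subst (p ∈_) e p∈) in from ∈prod (x , x∈ , _ , h x x∈ , q)) , e , h)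

  module _ {K : V → V → Set ℓ} .⦃ d : Def {2} (λ ρ → K (proj₁ ρ) (proj₁ (proj₂ ρ))) ⦄ where
    private instance
      dK : ∀ {n} {s t : Env n → V} → .⦃ DefTerm s ⦄ → .⦃ DefTerm t ⦄ → Def (λ ρ → K (s ρ) (t ρ))
      dK ⦃ s ⦄ ⦃ t ⦄ = defRel d s t
    private module F = Fallback tt
    opaque

      choiceFunction : ∀ a b → (∀ x → x ∈ a → ∃ λ y → y ∈ b × K x y) →
                       ∃ λ f → f ≡ ƛ a (f ·_) × (∀ x → x ∈ a → f · x ∈ b × K x (f · x))
      choiceFunction a b h = ƛ a (f ·_) , ƛ-canonical , λ x x∈ → subst (λ y → y ∈ b × K x y) (sym (ƛ-· x∈)) (value x x∈)
        where
        -- Tagging the candidates with `x` makes the blocks of different points disjoint, as the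
        -- axiom of choice requires.
        block : V → V
        block x = sep (prod a b) λ p → ∃ λ y → p ≡ ⟨ x , y ⟩ × K x y
        ∈block : ∀ {x p} → p ∈ block x ⇔ (p ∈ prod a b × ∃ λ y → p ≡ ⟨ x , y ⟩ × K x y)
        ∈block = ∈sep
        ∈blocks : ∀ {q} → q ∈ img a block ⇔ ∃ λ x → x ∈ a × q ≡ block x
        ∈blocks = ∈img
        nonempty : ∀ {q} → (∃ λ x → x ∈ a × q ≡ block x) → Nonempty q
        nonempty (x , x∈ , refl) = let y , y∈ , k = h x x∈ in ⟨ x , y ⟩ , from ∈block (from ⟨⟩∈prod (x∈ , y∈) , y , refl , k)
        disjoint : ∀ {q r p} → (∃ λ x → x ∈ a × q ≡ block x) → (∃ λ x → x ∈ a × r ≡ block x) → p ∈ q → p ∈ r → q ≡ r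
        disjoint {p = p} (x , _ , refl) (x′ , _ , refl) p∈q p∈r =
          let _ , _ , e  , _ = to ∈block p∈q
              _ , _ , e′ , _ = to ∈block p∈r
          in cong block (proj₁ (⟨⟩-injective (trans (sym e) e′)))
        transversal : ∃ λ c → ∀ q → q ∈ img a block → ∃! _≡_ λ z → z ∈ q × z ∈ c
        transversal = choice (img a block) (λ q q∈ → nonempty (to ∈blocks q∈))
          λ q r p q∈ r∈ → disjoint (to ∈blocks q∈) (to ∈blocks r∈)
        c f : V
        c = proj₁ transversal
        -- The choice set `c` may have elements outside all blocks; they must go before it is read
        -- as a function.
        f = sep c λ p → ∃ λ x → x ∈ a × p ∈ block x
        ∈f : ∀ {p} → p ∈ f ⇔ (p ∈ c × ∃ λ x → x ∈ a × p ∈ block x)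
        ∈f = ∈sep
        value : ∀ x → x ∈ a → f · x ∈ b × K x (f · x)
        value x x∈ =
          let p , (p∈ , p∈c) , u = proj₂ transversal (block x) (from ∈blocks (x , x∈ , refl))
              p∈prod , y , e , k = to ∈block p∈
          in subst (λ y → y ∈ b × K x y) (sym (·-value (subst (_∈ f) e (from ∈f (p∈c , x , x∈ , p∈))) λ y′ q →
               let q∈c , x′ , x′∈ , q∈ = to ∈f q
                   _ , _ , e′ , _ = to ∈block q∈
               in proj₂ (⟨⟩-injective (trans (sym (u (subst (λ x → ⟨ _ , y′ ⟩ ∈ block x) (sym (proj₁ (⟨⟩-injective e′))) q∈ , q∈c))) e))))
               (proj₂ (to ⟨⟩∈prod (subst (_∈ prod a b) e p∈prod)) , k)

  -- Recursion along well-founded relations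

  WellFounded : (V → V → Set ℓ) → V → Set ℓ
  WellFounded E D = (∀ u v → u ∈ D → E v u → v ∈ D)
                  × (∀ s → s ⊆ D → Nonempty s → ∃ λ m → m ∈ s × (∀ v → E v m → ¬ v ∈ s))

  module _ where
    private module F = Fallback tt

    wf-induction : ∀ {E D} {P : V → Set ℓ} → .⦃ Def {1} (λ ρ → P (proj₁ ρ)) ⦄ → WellFounded E D →
                   (∀ u → u ∈ D → (∀ v → E v u → P v) → P u) → ∀ u → u ∈ D → P u
    wf-induction {E} {D} {P} ⦃ d ⦄ (closed , minimal) step u u∈ = byContradiction contra
      where
      instance
        dP : ∀ {n} {s : Env n → V} → .⦃ DefTerm s ⦄ → Def (λ ρ → P (s ρ))
        dP ⦃ s ⦄ = defPred d s
      contra : ¬ ¬ P u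
      contra ¬Pu =
        let m , m∈ , h = minimal (sep D λ x → ¬ P x) (λ z → proj₁ ∘ to ∈sep) (u , from ∈sep (u∈ , ¬Pu))
            m∈D , ¬Pm = to ∈sep m∈
        in ¬Pm (step m m∈D λ v e → byContradiction λ ¬Pv → h v e (from ∈sep (closed m v m∈D e , ¬Pv)))

  -- val u is the value at u of the solution of val u = G {val v ∣ E v u}. It is
  -- defined from all set-sized partial solutions, so it does not depend on the
  -- set on which E is shown to be well-founded.
  module Recursion (E : V → V → Set ℓ) .(dE : Def {2} (λ ρ → E (proj₁ ρ) (proj₁ (proj₂ ρ))))
                   (G : V → V) .(dG : DefTerm {1} (λ ρ → G (proj₁ ρ))) where

    private
      instance
        defE : ∀ {n} {s t : Env n → V} → .⦃ DefTerm s ⦄ → .⦃ DefTerm t ⦄ → Def (λ ρ → E (s ρ) (t ρ))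
        defE ⦃ s ⦄ ⦃ t ⦄ = defRel dE s t
        defG : ∀ {n} {s : Env n → V} → .⦃ DefTerm s ⦄ → DefTerm (λ ρ → G (s ρ))
        defG ⦃ s ⦄ = defFun₁ dG s

    preds : V → V → V
    preds f u = setOf λ z → ∃ λ v → E v u × ⟨ v , z ⟩ ∈ f

    PartialSolution : V → Set ℓ
    PartialSolution f = ∀ u y → ⟨ u , y ⟩ ∈ f → (∀ v → E v u → ∃ λ z → ⟨ v , z ⟩ ∈ f) × y ≡ G (preds f u)

    opaque
      Val : V → V → Set ℓ
      Val u y = ∃ λ f → PartialSolution f × ⟨ u , y ⟩ ∈ f

      private
        module F₁ = Fallback tt
        graphVal : Def {2} (λ ρ → Val (proj₁ ρ) (proj₁ (proj₂ ρ)))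
        graphVal = def∃

    private instance
      defVal : ∀ {n} {s t : Env n → V} → .⦃ DefTerm s ⦄ → .⦃ DefTerm t ⦄ → Def (λ ρ → Val (s ρ) (t ρ))
      defVal ⦃ s ⦄ ⦃ t ⦄ = defRel graphVal s t

    opaque
      val : V → V
      val u = setOf λ z → ∃ λ y → Val u y × z ∈ y

      private
        module F₂ = Fallback tt
        graphval : DefTerm {1} (λ ρ → val (proj₁ ρ))
        graphval = defSetOf

    instance
      defval : ∀ {n} {s : Env n → V} → .⦃ DefTerm s ⦄ → DefTerm (λ ρ → val (s ρ))
      defval ⦃ s ⦄ = defFun₁ graphval s

    vals : V → V
    vals u = setOf λ z → ∃ λ v → E v u × z ≡ val v

    module _ {D} (wf : WellFounded E D) where
      private module F = Fallback tt
      opaque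
        unfolding Val val

        ∈preds : ∀ {f u z} → z ∈ preds f u ⇔ ∃ λ v → E v u × ⟨ v , z ⟩ ∈ f
        ∈preds {f} {u} = ∈setOf (bounded-set (⋃ (⋃ f)) λ z (v , _ , p) → from ∈⋃ (_ ,
          from ∈⋃ (_ , p , proj₂ ∈⟨⟩) , from ∈pair (inj₂ refl)))

        preds-cong : ∀ f g u → (∀ v z → E v u → ⟨ v , z ⟩ ∈ f → ⟨ v , z ⟩ ∈ g) →
                     (∀ v z → E v u → ⟨ v , z ⟩ ∈ g → ⟨ v , z ⟩ ∈ f) → preds f u ≡ preds g u
        preds-cong f g u h k = ext
          (λ z z∈ → let v , e , p = to ∈preds z∈ in from ∈preds (v , e , h v z e p))
          (λ z z∈ → let v , e , p = to ∈preds z∈ in from ∈preds (v , e , k v z e p))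

        Val-unique : ∀ u → u ∈ D → ∀ y y′ → Val u y → Val u y′ → y ≡ y′
        Val-unique = wf-induction wf λ u u∈ IH y y′ (f , sf , p) (g , sg , q) →
          let hf , ef = sf u y p
              hg , eg = sg u y′ q
          in trans ef (trans (cong G (preds-cong f g u
              (λ v z e r → let z′ , r′ = hg v e in
                subst (λ z → ⟨ v , z ⟩ ∈ g) (IH v e z′ z (g , sg , r′) (f , sf , r)) r′)
              (λ v z e r → let z′ , r′ = hf v e in
                subst (λ z → ⟨ v , z ⟩ ∈ f) (IH v e z′ z (f , sf , r′) (g , sg , r)) r′))) (sym eg))

        Val⇒val : ∀ {u y} → u ∈ D → Val u y → val u ≡ y
        Val⇒val {u} {y} u∈ h = ext
          (λ z z∈ → let y′ , h′ , k = to ∈val z∈ in subst (z ∈_) (Val-unique u u∈ y′ y h′ h) k)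
          (λ z z∈ → from ∈val (y , h , z∈))
          where
          ∈val : ∀ {z} → z ∈ val u ⇔ ∃ λ y → Val u y × z ∈ y
          ∈val = ∈setOf (bounded-set y λ z (y′ , h′ , k) → subst (z ∈_) (Val-unique u u∈ y′ y h′ h) k)

        Val-exists : ∀ u → u ∈ D → ∃ λ y → Val u y
        Val-exists = wf-induction wf λ u u∈ IH → byContradiction (contra u u∈ IH)
          where
          contra : ∀ u → u ∈ D → (∀ v → E v u → ∃ λ y → Val v y) → ¬ ¬ (∃ λ y → Val u y)
          contra u u∈ IH ¬h = ¬h (y₀ , F′ , solF′ , from ∈∪ (inj₂ (from ∈pair (inj₁ refl))))
            where
            S F F′ y₀ : V
            S  = sep D λ v → ∃ λ y → Val v y
            F  = img S λ v → ⟨ v , val v ⟩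
            y₀ = G (preds F u)
            F′ = F ∪ pair ⟨ u , y₀ ⟩ ⟨ u , y₀ ⟩
            inF : ∀ {v y} → v ∈ D → Val v y → ⟨ v , y ⟩ ∈ F
            inF {v} v∈ h = from ∈img (v , from ∈sep (v∈ , _ , h) , cong ⟨ v ,_⟩ (sym (Val⇒val v∈ h)))
            outF : ∀ {v y} → ⟨ v , y ⟩ ∈ F → v ∈ D × Val v y
            outF p with to ∈img p
            ... | v , v∈ , e with ⟨⟩-injective e | to ∈sep v∈
            ...   | refl , e′ | v∈D , y , h = v∈D , subst (Val v) (sym (trans e′ (Val⇒val v∈D h))) h
            -- Were `u` a predecessor of `v`, then `h` would give it a value, against `¬h`. So the
            -- pair added at `u` does not show in `preds F′ v`.
            same : ∀ v → (∀ w → E w v → ∃ λ y → Val w y) → preds F v ≡ preds F′ v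
            same v h = preds-cong F F′ v (λ _ _ _ → from ∈∪ ∘ inj₁) back
              where
              back : ∀ w z → E w v → ⟨ w , z ⟩ ∈ F′ → ⟨ w , z ⟩ ∈ F
              back w z e p with to ∈∪ p
              ... | inj₁ q = q
              ... | inj₂ q with ⟨⟩-injective (Sum.[ id , id ]′ (to ∈pair q))
              ...   | refl , _ = ⊥-elim (¬h (h w e))
            solF′ : PartialSolution F′
            solF′ v y p with to ∈∪ p
            ... | inj₂ q with ⟨⟩-injective (Sum.[ id , id ]′ (to ∈pair q))
            ...   | refl , refl = (λ w e → let z , h = IH w e in z , from ∈∪ (inj₁ (inF (proj₁ wf v w u∈ e) h))) , cong G (same v IH)
            solF′ v y p | inj₁ q with outF q
            ... | v∈ , f , sf , r with sf v y r
            ...   | hf , ef = (λ w e → let z , k = hf w e in z , from ∈∪ (inj₁ (inF (proj₁ wf v w v∈ e) (f , sf , k)))) ,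
              trans ef (cong G (trans (preds-cong f F v
                (λ w z e k → inF (proj₁ wf v w v∈ e) (f , sf , k))
                (λ w z e k → let z′ , k′ = hf w e
                                 w∈ , h = outF k
                             in subst (λ z → ⟨ w , z ⟩ ∈ f) (Val-unique w w∈ _ _ (f , sf , k′) h) k′))
                (same v λ w e → let z , k = hf w e in z , f , sf , k)))

        private
          solved : ∀ {u} → u ∈ D → ∃ λ p → (∀ z → z ∈ p ⇔ ∃ λ v → E v u × z ≡ val v) × val u ≡ G p
          solved {u} u∈ with Val-exists u u∈
          ... | y , f , sf , p with sf u y p
          ...   | hf , ef = preds f u , (λ z → mk⇔
            (λ z∈ → let v , e , q = to ∈preds z∈ in v , e , sym (Val⇒val (proj₁ wf u v u∈ e) (f , sf , q)))
            (λ (v , e , z≡) → let z′ , q = hf v e in from ∈preds (v , e ,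
              subst (λ z → ⟨ v , z ⟩ ∈ f) (trans (sym (Val⇒val (proj₁ wf u v u∈ e) (f , sf , q))) (sym z≡)) q))) ,
            trans (Val⇒val u∈ (f , sf , p)) ef

        ∈vals : ∀ {u z} → u ∈ D → z ∈ vals u ⇔ ∃ λ v → E v u × z ≡ val v
        ∈vals u∈ = let p , h , _ = solved u∈ in ∈setOf (p , h)

        val-unfold : ∀ {u} → u ∈ D → val u ≡ G (vals u)
        val-unfold u∈ = let p , h , e = solved u∈ in
          trans e (cong G (ext (λ z → from (∈vals u∈) ∘ to (h z)) (λ z → from (h z) ∘ to (∈vals u∈))))

  -- Ordinals and the natural numbers

  Trans : V → Set ℓ
  Trans x = ∀ y → y ∈ x → y ⊆ x

  -- Equivalent to `IsOrdinal` by foundation. Having only bounded quantifiers and none over subsets,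
  -- this form passes through the ultrapower coordinatewise.
  Ord : V → Set ℓ
  Ord α = Trans α × (∀ x → x ∈ α → Trans x)

  ∈-wellFounded : ∀ {D} → Trans D → WellFounded _∈_ D
  ∈-wellFounded t = (λ u v u∈ v∈ → t u u∈ v v∈) , λ s _ ne → foundation s ne

  module _ where
    private module F = Fallback tt

    opaque
      isSuccessor : ∀ {s x} → IsSuccessor s x ⇔ s ≡ succ x
      isSuccessor = mk⇔ (λ h → ext (λ z → from ∈succ ∘ to (h z)) (λ z → from (h z) ∘ to ∈succ)) λ { refl z → ∈succ }

      self∈succ : ∀ {x} → x ∈ succ x
      self∈succ = from ∈succ (inj₂ refl)

      succ-injective : ∀ {x y} → succ x ≡ succ y → x ≡ y
      succ-injective {x} {y} e with to ∈succ (subst (x ∈_) e self∈succ) | to ∈succ (subst (y ∈_) (sym e) self∈succ)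
      ... | inj₂ x≡y | _        = x≡y
      ... | inj₁ _   | inj₂ y≡x = sym y≡x
      ... | inj₁ x∈y | inj₁ y∈x = ⊥-elim (∈-asym x∈y y∈x)

      succ-trans : ∀ {x} → Trans x → Trans (succ x)
      succ-trans t y y∈ z z∈ with to ∈succ y∈
      ... | inj₁ y∈x  = from ∈succ (inj₁ (t y y∈x z z∈))
      ... | inj₂ refl = from ∈succ (inj₁ z∈)

      IsOrdinal⇒Ord : ∀ {α} → IsOrdinal α → Ord α
      IsOrdinal⇒Ord (t , wo) = t , λ x x∈ y y∈ z z∈ →
        let y∈α = t x x∈ y y∈ in WellOrders.trans wo z y x (t y y∈α z z∈) y∈α x∈ z∈ y∈

      Ord-∈ : ∀ {α x} → Ord α → x ∈ α → Ord x
      Ord-∈ (t , h) x∈ = h _ x∈ , λ y y∈ → h y (t _ x∈ y y∈)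

      ord-induction : {P : V → Set ℓ} → .⦃ Def {1} (λ ρ → P (proj₁ ρ)) ⦄ →
                      (∀ α → Ord α → (∀ β → β ∈ α → P β) → P α) → ∀ α → Ord α → P α
      ord-induction {P} step α o = wf-induction {D = succ α} {P} (∈-wellFounded (succ-trans (proj₁ o)))
        (λ u u∈ → step u (ord u (to ∈succ u∈))) α self∈succ
        where
        ord : ∀ u → u ∈ α ⊎ u ≡ α → Ord u
        ord u (inj₁ h)    = Ord-∈ o h
        ord u (inj₂ refl) = o

      ord-total : ∀ α → Ord α → ∀ β → Ord β → α ∈ β ⊎ α ≡ β ⊎ β ∈ α
      ord-total = ord-induction λ α oα IHα → ord-induction λ β oβ IHβ → compare α oα IHα β oβ IHβ
        where
        compare : ∀ α → Ord α → (∀ γ → γ ∈ α → ∀ β → Ord β → γ ∈ β ⊎ γ ≡ β ⊎ β ∈ γ) → ∀ β → Ord β →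
                  (∀ γ → γ ∈ β → α ∈ γ ⊎ α ≡ γ ⊎ γ ∈ α) → α ∈ β ⊎ α ≡ β ⊎ β ∈ α
        compare α oα IHα β oβ IHβ with decide (α ∈ β) | decide (β ∈ α)
        ... | inj₁ h | _ = inj₁ h
        ... | inj₂ _ | inj₁ h = inj₂ (inj₂ h)
        ... | inj₂ α∉β | inj₂ β∉α = inj₂ (inj₁ (ext sub₁ sub₂))
          where
          sub₁ : α ⊆ β
          sub₁ x x∈ with IHα x x∈ β oβ
          ... | inj₁ h           = h
          ... | inj₂ (inj₁ refl) = ⊥-elim (β∉α x∈)
          ... | inj₂ (inj₂ h)    = ⊥-elim (β∉α (proj₁ oα x x∈ β h))
          sub₂ : β ⊆ α
          sub₂ x x∈ with IHβ x x∈
          ... | inj₁ h           = ⊥-elim (α∉β (proj₁ oβ x x∈ α h))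
          ... | inj₂ (inj₁ refl) = ⊥-elim (α∉β x∈)
          ... | inj₂ (inj₂ h)    = h

      Ord⇒IsOrdinal : ∀ {α} → Ord α → IsOrdinal α
      Ord⇒IsOrdinal {α} o = proj₁ o , record
        { irrefl  = λ _ _ → ∈-irrefl
        ; trans   = λ x y z _ _ z∈ x∈y y∈z → proj₂ o z z∈ y y∈z x x∈y
        ; total   = λ x y x∈ y∈ → ord-total x (Ord-∈ o x∈) y (Ord-∈ o y∈)
        ; minimum = λ s s⊆ ne → let m , m∈ , h = foundation s ne in m , m∈ , λ x x∈ → least s⊆ h x m∈ x∈ }
        where
        least : ∀ {s m} → s ⊆ α → (∀ z → z ∈ m → ¬ z ∈ s) → ∀ x → m ∈ s → x ∈ s → m ≡ x ⊎ m ∈ x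
        least {s} {m} s⊆ h x m∈ x∈ with ord-total m (Ord-∈ o (s⊆ m m∈)) x (Ord-∈ o (s⊆ x x∈))
        ... | inj₁ k        = inj₂ k
        ... | inj₂ (inj₁ k) = inj₁ k
        ... | inj₂ (inj₂ k) = ⊥-elim (h x k x∈)

      ord-⊆ : ∀ {α β} → Ord α → Ord β → α ⊆ β → α ≤ β
      ord-⊆ {α} {β} oα oβ h with ord-total α oα β oβ
      ... | inj₁ k        = inj₁ k
      ... | inj₂ (inj₁ k) = inj₂ k
      ... | inj₂ (inj₂ k) = ⊥-elim (∈-irrefl (h β k))

      ≤⇒⊆ : ∀ {α β} → Ord β → α ≤ β → α ⊆ β
      ≤⇒⊆ o (inj₁ h)    = proj₁ o _ h
      ≤⇒⊆ o (inj₂ refl) = λ _ → id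

      ∉⇒⊇ : ∀ {α β} → Ord α → Ord β → ¬ α ∈ β → β ⊆ α
      ∉⇒⊇ {α} {β} oα oβ h with ord-total α oα β oβ
      ... | inj₁ k           = ⊥-elim (h k)
      ... | inj₂ (inj₁ refl) = λ _ → id
      ... | inj₂ (inj₂ k)    = proj₁ oα β k

      least-ordinal : {P : V → Set ℓ} → .⦃ Def {1} (λ ρ → P (proj₁ ρ)) ⦄ → ∀ α → Ord α → P α →
                      ∃ λ β → Ord β × P β × β ∈ succ α × (∀ γ → γ ∈ β → ¬ P γ)
      least-ordinal {P} α o p =
        let m , m∈ , h = foundation (sep (succ α) P) (α , from ∈sep (self∈succ , p))
            m∈s , Pm   = to ∈sep m∈
        in m , ord (to ∈succ m∈s) , Pm , m∈s , λ γ γ∈ Pγ → h γ γ∈ (from ∈sep (succ-trans (proj₁ o) m m∈s γ γ∈ , Pγ))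
        where
        ord : ∀ {u} → u ∈ α ⊎ u ≡ α → Ord u
        ord (inj₁ h)    = Ord-∈ o h
        ord (inj₂ refl) = o

  module Omega (w : V) (isω : IsOmega w) where
    module _ where
      private module F = Fallback tt
      opaque
        ∅∈ω : ∅ ∈ w
        ∅∈ω = proj₁ (proj₁ isω) ∅ λ _ → ∉∅

        succ∈ω : ∀ {n} → n ∈ w → succ n ∈ w
        succ∈ω {n} n∈ = proj₂ (proj₁ isω) n (succ n) n∈ (from isSuccessor refl)

        ω-induction : {P : V → Set ℓ} → .⦃ Def {1} (λ ρ → P (proj₁ ρ)) ⦄ →
                      P ∅ → (∀ n → n ∈ w → P n → P (succ n)) → ∀ n → n ∈ w → P n
        ω-induction {P} p₀ ps n n∈ = proj₂ (to ∈sep (proj₂ isω (sep w P)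
          ( (λ e h → subst (_∈ sep w P) (sym (empty h)) (from ∈sep (∅∈ω , p₀)))
          , λ x s x∈ h → let x∈w , px = to ∈sep x∈ in
              subst (_∈ sep w P) (sym (to isSuccessor h)) (from ∈sep (succ∈ω x∈w , ps x x∈w px)))
          n n∈))

        ω-trans : Trans w
        ω-trans = ω-induction (λ z z∈ → ⊥-elim (∉∅ z∈)) λ n n∈ h z z∈ → Sum.[ h z , (λ { refl → n∈ }) ]′ (to ∈succ z∈)

        def⋃ : DefTerm {1} (λ ρ → ⋃ (proj₁ ρ))
        def⋃ = defSetOf

    module Iteration (x₀ : V) (h : V → V) .(dh : DefTerm {1} (λ ρ → h (proj₁ ρ))) where
      private
        instance
          defh : ∀ {n} {s : Env n → V} → .⦃ DefTerm s ⦄ → DefTerm (λ ρ → h (s ρ))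
          defh ⦃ s ⦄ = defFun₁ dh s

        -- The argument `t` is the set of values at predecessors: empty at `∅`, and at a successor
        -- the singleton of the preceding value, which `⋃ t` recovers.
        step : V → V
        step t = setOf λ z → (IsEmpty t × z ∈ x₀) ⊎ (Nonempty t × z ∈ h (⋃ t))

      module _ where
        private module F = Fallback tt
        opaque
          defStep : DefTerm {1} (λ ρ → step (proj₁ ρ))
          defStep = defSetOf

          defIsSucc : Def {2} (λ ρ → proj₁ (proj₂ ρ) ≡ succ (proj₁ ρ))
          defIsSucc = def≡

      open Recursion (λ v u → u ≡ succ v) defIsSucc step defStep public using () renaming (val to iterate; defval to defIterate)
      private
        module R = Recursion (λ v u → u ≡ succ v) defIsSucc step defStep
        module F = Fallback tt

      opaque
        wf-succ : WellFounded (λ v u → u ≡ succ v) w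
        wf-succ = (λ { u v u∈ refl → ω-trans u u∈ v self∈succ }) ,
          λ s _ ne → let m , m∈ , min = foundation s ne in m , m∈ , λ v e → min v (subst (v ∈_) (sym e) self∈succ)

        iterate-∅ : iterate ∅ ≡ x₀
        iterate-∅ = trans (R.val-unfold wf-succ ∅∈ω) (ext
          (λ z z∈ → Sum.[ proj₂ , (λ ((_ , y∈) , _) → ⊥-elim (none y∈)) ]′ (to ∈step z∈))
          (λ z z∈ → from ∈step (inj₁ ((λ _ → none) , z∈))))
          where
          none : ∀ {y} → ¬ y ∈ R.vals ∅
          none y∈ = let v , e , _ = to (R.∈vals wf-succ ∅∈ω) y∈ in ∉∅ (subst (v ∈_) (sym e) self∈succ)
          ∈step : ∀ {z} → z ∈ step (R.vals ∅) ⇔ ((IsEmpty (R.vals ∅) × z ∈ x₀) ⊎ (Nonempty (R.vals ∅) × z ∈ h (⋃ (R.vals ∅))))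
          ∈step = ∈setOf (bounded-set (x₀ ∪ h (⋃ (R.vals ∅))) λ { _ (inj₁ (_ , k)) → from ∈∪ (inj₁ k) ; _ (inj₂ (_ , k)) → from ∈∪ (inj₂ k) })

        iterate-succ : ∀ {n} → n ∈ w → iterate (succ n) ≡ h (iterate n)
        iterate-succ {n} n∈ = trans (R.val-unfold wf-succ (succ∈ω n∈)) (trans (ext
          (λ z z∈ → Sum.[ (λ (e , _) → ⊥-elim (e _ one)) , proj₂ ]′ (to ∈step z∈))
          (λ z z∈ → from ∈step (inj₂ ((_ , one) , z∈)))) (cong h ⋃≡))
          where
          t : V
          t = R.vals (succ n)
          one : iterate n ∈ t
          one = from (R.∈vals wf-succ (succ∈ω n∈)) (n , refl , refl)
          only : ∀ {y} → y ∈ t → y ≡ iterate n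
          only y∈ = let v , e , y≡ = to (R.∈vals wf-succ (succ∈ω n∈)) y∈ in trans y≡ (cong iterate (sym (succ-injective e)))
          ⋃≡ : ⋃ t ≡ iterate n
          ⋃≡ = ext (λ z z∈ → let y , y∈ , k = to ∈⋃ z∈ in subst (z ∈_) (only y∈) k) (λ z z∈ → from ∈⋃ (_ , one , z∈))
          ∈step : ∀ {z} → z ∈ step t ⇔ ((IsEmpty t × z ∈ x₀) ⊎ (Nonempty t × z ∈ h (⋃ t)))
          ∈step = ∈setOf (bounded-set (x₀ ∪ h (⋃ t)) λ { _ (inj₁ (_ , k)) → from ∈∪ (inj₁ k) ; _ (inj₂ (_ , k)) → from ∈∪ (inj₂ k) })

    module _ (x : V) where
      private
        module I = Iteration x ⋃ def⋃
        module F = Fallback tt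

      opaque
        transitive-superset : ∃ λ t → x ⊆ t × Trans t
        transitive-superset = ⋃ (img w I.iterate) ,
          (λ z z∈ → from ∈⋃ (_ , from ∈img (∅ , ∅∈ω , refl) , subst (z ∈_) (sym I.iterate-∅) z∈)) ,
          λ y y∈ z z∈ →
            let s , s∈ , k = to ∈⋃ y∈
                n , n∈ , e = to ∈img s∈
            in from ∈⋃ (_ , from ∈img (succ n , succ∈ω n∈ , refl) ,
                 subst (z ∈_) (sym (I.iterate-succ n∈)) (from ∈⋃ (y , subst (y ∈_) e k , z∈)))

  -- Cardinality

  -- A definable relation replaces the set of pairs, which `equinumerous` builds once for all uses.
  record Bijection (K : V → V → Set ℓ) (a b : V) : Set ℓ where
    field
      total      : ∀ x → x ∈ a → ∃ λ y → y ∈ b × K x y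
      functional : ∀ x y y′ → x ∈ a → y ∈ b → y′ ∈ b → K x y → K x y′ → y ≡ y′
      injective  : ∀ x x′ y → x ∈ a → x′ ∈ a → y ∈ b → K x y → K x′ y → x ≡ x′
      surjective : ∀ y → y ∈ b → ∃ λ x → x ∈ a × K x y

  module _ {K : V → V → Set ℓ} .⦃ d : Def {2} (λ ρ → K (proj₁ ρ) (proj₁ (proj₂ ρ))) ⦄ where
    private instance
      dK : ∀ {n} {s t : Env n → V} → .⦃ DefTerm s ⦄ → .⦃ DefTerm t ⦄ → Def (λ ρ → K (s ρ) (t ρ))
      dK ⦃ s ⦄ ⦃ t ⦄ = defRel d s t
    private module F = Fallback tt

    opaque
      equinumerous : ∀ {a b} → Bijection K a b → Equinumerous a b
      equinumerous {a} {b} bij = f ,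
        ( (λ p p∈ → let x , x∈ , y , y∈ , e = to ∈prod (proj₁ (to ∈sep p∈)) in x , y , x∈ , y∈ , from isOrderedPair e)
        , λ x x∈ → let y , y∈ , k = total x x∈ in y , from related (from graph (x∈ , y∈ , k)) ,
            λ r → let _ , y′∈ , k′ = to graph (to related r) in functional x _ _ x∈ y∈ y′∈ k k′)
        , (λ x x′ y r r′ → let x∈ , y∈ , k = to graph (to related r)
                               x′∈ , _ , k′ = to graph (to related r′)
                           in injective x x′ y x∈ x′∈ y∈ k k′)
        , λ y y∈ → let x , x∈ , k = surjective y y∈ in x , from related (from graph (x∈ , y∈ , k))
        where
        open Bijection bij
        f : V
        f = sep (prod a b) λ p → ∃ λ x → ∃ λ y → p ≡ ⟨ x , y ⟩ × K x y
        graph : ∀ {x y} → ⟨ x , y ⟩ ∈ f ⇔ (x ∈ a × y ∈ b × K x y)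
        graph {x} {y} = mk⇔ g (λ (x∈ , y∈ , k) → from ∈sep (from ⟨⟩∈prod (x∈ , y∈) , x , y , refl , k))
          where
          g : ⟨ x , y ⟩ ∈ f → x ∈ a × y ∈ b × K x y
          g p with to ∈sep p
          ... | p∈ , x′ , y′ , e , k with ⟨⟩-injective e | to ⟨⟩∈prod p∈
          ...   | refl , refl | x∈ , y∈ = x∈ , y∈ , k

  module _ where
    private module F = Fallback tt
    opaque
      bijection-graph : ∀ {f a b} → IsBijection f a b → Bijection (λ x y → ⟨ x , y ⟩ ∈ f) a b
      bijection-graph {f} (F , i , s) = record
        { total      = λ x x∈ → let y∈ , p = isFunction-apply F x∈ in _ , y∈ , p
        ; functional = λ x y y′ _ _ _ p q → trans (proj₂ (isFunction-graph F p)) (sym (proj₂ (isFunction-graph F q)))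
        ; injective  = λ x x′ y _ _ _ p q → i x x′ y (from related p) (from related q)
        ; surjective = λ y y∈ → let x , r = s y y∈ in x , proj₁ (isFunction-graph F (to related r)) , to related r
        }

      equinumerous-sym : ∀ {a b} → Equinumerous a b → Equinumerous b a
      equinumerous-sym (f , F) = let open Bijection (bijection-graph F) in equinumerous {λ y x → ⟨ x , y ⟩ ∈ f} record
        { total      = surjective
        ; functional = λ y x x′ y∈ x∈ x′∈ → injective x x′ y x∈ x′∈ y∈
        ; injective  = λ y y′ x y∈ y′∈ x∈ → functional x y y′ x∈ y∈ y′∈
        ; surjective = total
        }

      equinumerous-trans : ∀ {a b c} → Equinumerous a b → Equinumerous b c → Equinumerous a c
      equinumerous-trans {b = b} (f , F) (g , G) = equinumerous {λ x z → ∃ λ y → y ∈ b × ⟨ x , y ⟩ ∈ f × ⟨ y , z ⟩ ∈ g} record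
        { total      = λ x x∈ → let y , y∈ , p = P.total x x∈ ; z , z∈ , q = Q.total y y∈ in z , z∈ , y , y∈ , p , q
        ; functional = λ { x z z′ x∈ z∈ z′∈ (y , y∈ , p , q) (y′ , y′∈ , p′ , q′) →
            Q.functional y z z′ y∈ z∈ z′∈ q (subst (λ y → ⟨ y , z′ ⟩ ∈ g) (P.functional x y′ y x∈ y′∈ y∈ p′ p) q′) }
        ; injective  = λ { x x′ z x∈ x′∈ z∈ (y , y∈ , p , q) (y′ , y′∈ , p′ , q′) →
            P.injective x x′ y x∈ x′∈ y∈ p (subst (λ y → ⟨ x′ , y ⟩ ∈ f) (Q.injective y′ y z y′∈ y∈ z∈ q′ q) p′) }
        ; surjective = λ z z∈ → let y , y∈ , q = Q.surjective z z∈ ; x , x∈ , p = P.surjective y y∈ in x , x∈ , y , y∈ , p , q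
        }
        where
        module P = Bijection (bijection-graph F)
        module Q = Bijection (bijection-graph G)

      equinumerous-refl : ∀ {a} → Equinumerous a a
      equinumerous-refl = equinumerous {_≡_} record
        { total      = λ x x∈ → x , x∈ , refl
        ; functional = λ { x y y′ _ _ _ refl refl → refl }
        ; injective  = λ { x y y′ _ _ _ refl refl → refl }
        ; surjective = λ x x∈ → x , x∈ , refl
        }

      schröder-bernstein : ∀ {μ κ h} → μ ⊆ κ → (∀ x → x ∈ κ → h · x ∈ μ) →
                           (∀ x x′ → x ∈ κ → x′ ∈ κ → h · x ≡ h · x′ → x ≡ x′) → Equinumerous κ μ
      schröder-bernstein {μ} {κ} {h} μ⊆κ into inj = equinumerous {K} record
        { total      = total
        ; functional = λ { x y y′ _ _ _ (inj₁ (_ , refl)) (inj₁ (_ , refl)) → refl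
                         ; x y y′ _ _ _ (inj₁ (c , _)) (inj₂ (¬c , _)) → ⊥-elim (¬c c)
                         ; x y y′ _ _ _ (inj₂ (¬c , _)) (inj₁ (c , _)) → ⊥-elim (¬c c)
                         ; x y y′ _ _ _ (inj₂ (_ , refl)) (inj₂ (_ , refl)) → refl }
        ; injective  = λ { x x′ y x∈ x′∈ _ (inj₁ (_ , e)) (inj₁ (_ , e′)) → inj x x′ x∈ x′∈ (trans (sym e) e′)
                         ; x x′ y _ _ _ (inj₁ (c , refl)) (inj₂ (¬c , refl)) → ⊥-elim (¬c (h-closed c))
                         ; x x′ y _ _ _ (inj₂ (¬c , refl)) (inj₁ (c , refl)) → ⊥-elim (¬c (h-closed c))
                         ; x x′ y _ _ _ (inj₂ (_ , refl)) (inj₂ (_ , refl)) → refl }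
        ; surjective = surjective
        }
        where
        Closed : V → Set ℓ
        Closed X = (∀ z → z ∈ κ → ¬ z ∈ μ → z ∈ X) × (∀ z → z ∈ κ → z ∈ X → h · z ∈ X)
        C : V
        -- The least set that contains the complement of `μ` in `κ` and is closed under `h`. The
        -- bijection `K` is `h` on `C` and the identity off `C`.
        C = sep κ λ x → ∀ X → Closed X → x ∈ X
        K : V → V → Set ℓ
        K x y = (x ∈ C × y ≡ h · x) ⊎ (¬ x ∈ C × y ≡ x)
        h-closed : ∀ {x} → x ∈ C → h · x ∈ C
        h-closed c = let x∈ , k = to ∈sep c in
          from ∈sep (μ⊆κ _ (into _ x∈) , λ X cl → proj₂ cl _ x∈ (k X cl))
        C-closed : Closed C
        C-closed = (λ z z∈ z∉ → from ∈sep (z∈ , λ X cl → proj₁ cl z z∈ z∉)) , λ z _ → h-closed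
        total : ∀ x → x ∈ κ → ∃ λ y → y ∈ μ × K x y
        total x x∈ with decide (x ∈ C)
        ... | inj₁ c  = h · x , into x x∈ , inj₁ (c , refl)
        ... | inj₂ ¬c = x , byContradiction (λ x∉ → ¬c (proj₁ C-closed x x∈ x∉)) , inj₂ (¬c , refl)
        surjective : ∀ y → y ∈ μ → ∃ λ x → x ∈ κ × K x y
        surjective y y∈ with decide (y ∈ C)
        ... | inj₂ ¬c = y , μ⊆κ y y∈ , inj₂ (¬c , refl)
        -- If `y` had no preimage, then `C` without `y` would still be closed, against the
        -- minimality of `C`.
        ... | inj₁ c  = byContradiction λ none → proj₂ (to ∈sep (proj₂ (to ∈sep c) C′ (closed none))) refl
          where
          C′ : V
          C′ = sep C λ z → ¬ z ≡ y
          closed : ¬ (∃ λ x → x ∈ κ × K x y) → Closed C′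
          closed none =
            (λ z z∈ z∉ → from ∈sep (proj₁ C-closed z z∈ z∉ , λ { refl → z∉ y∈ })) ,
            λ z z∈ z∈C′ → let z∈C = proj₁ (to ∈sep z∈C′) in
              from ∈sep (h-closed z∈C , λ e → none (z , z∈ , inj₁ (z∈C , sym e)))

      cardinal-≤ : ∀ {a} α → Ord α → Equinumerous a α →
                   ∃ λ κ → IsCardinal κ × Ord κ × κ ∈ succ α × Equinumerous a κ
      cardinal-≤ {a} α o e =
        let κ , oκ , eκ , κ∈ , least = least-ordinal {Graph} α o (graph e)
            e′ = ungraph eκ
        in κ , (Ord⇒IsOrdinal oκ , λ β β∈ e″ → least β β∈ (graph (equinumerous-trans e′ (equinumerous-sym e″)))) , oκ , κ∈ , e′
        where
        -- Equinumerous a b without the encoding of ordered pairs, which keeps the instance search short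
        Graph : V → Set ℓ
        Graph b = ∃ λ f → (∀ x → x ∈ a → ∃ λ y → y ∈ b × ⟨ x , y ⟩ ∈ f)
                        × (∀ x y y′ → x ∈ a → y ∈ b → y′ ∈ b → ⟨ x , y ⟩ ∈ f → ⟨ x , y′ ⟩ ∈ f → y ≡ y′)
                        × (∀ x x′ y → x ∈ a → x′ ∈ a → y ∈ b → ⟨ x , y ⟩ ∈ f → ⟨ x′ , y ⟩ ∈ f → x ≡ x′)
                        × (∀ y → y ∈ b → ∃ λ x → x ∈ a × ⟨ x , y ⟩ ∈ f)
        graph : ∀ {b} → Equinumerous a b → Graph b
        graph (f , F) = let open Bijection (bijection-graph F) in f , total , functional , injective , surjective
        ungraph : ∀ {b} → Graph b → Equinumerous a b
        ungraph (f , t , fn , i , s) = equinumerous {λ x y → ⟨ x , y ⟩ ∈ f} record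
          { total = t ; functional = fn ; injective = i ; surjective = s }

  module _ {K : V → V → Set ℓ} .⦃ d : Def {2} (λ ρ → K (proj₁ ρ) (proj₁ (proj₂ ρ))) ⦄ where
    opaque
      -- The relation may be multivalued: choice thins it to a function and injectivity survives.
      -- The three counting arguments below all end here.
      cardinal-no-injection : ∀ {κ μ} → IsCardinal κ → μ ∈ κ → (∀ x → x ∈ κ → ∃ λ y → y ∈ μ × K x y) →
                              (∀ x x′ y → x ∈ κ → x′ ∈ κ → y ∈ μ → K x y → K x′ y → x ≡ x′) → ⊥
      cardinal-no-injection {κ} {μ} (oκ , c) μ∈ total inj with choiceFunction {K} κ μ total
      ... | h , _ , H = c μ μ∈ (equinumerous-sym (schröder-bernstein {h = h} (proj₁ oκ μ μ∈) (λ x x∈ → proj₁ (H x x∈))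
        λ x x′ x∈ x′∈ e → inj x x′ _ x∈ x′∈ (proj₁ (H x x∈)) (proj₂ (H x x∈)) (subst (K x′) (sym e) (proj₂ (H x′ x′∈)))))

  -- Ultrafilters

  module Ultrafilter {δ U : V} (uf : IsUltrafilter U δ) where
    open IsUltrafilter uf

    AE : (V → Set ℓ) → Set ℓ
    AE P = sep δ P ∈ U

    module _ {P Q : V → Set ℓ} .⦃ p : Def {1} (λ ρ → P (proj₁ ρ)) ⦄ .⦃ q : Def {1} (λ ρ → Q (proj₁ ρ)) ⦄ where
      opaque
        ae-mono : (∀ ξ → ξ ∈ δ → P ξ → Q ξ) → AE P → AE Q
        ae-mono h = λ a → upward _ _ a
          (λ x x∈ → let x∈δ , px = to ∈sep x∈ in from ∈sep (x∈δ , h x x∈δ px))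
          (λ x x∈ → proj₁ (to ∈sep x∈))

        ae-and : AE P → AE Q → AE (λ ξ → P ξ × Q ξ)
        ae-and a b = intersection _ _ _ a b λ x → mk⇔
          (λ x∈ → let x∈δ , px , qx = to and x∈ in from ∈sep (x∈δ , px) , from ∈sep (x∈δ , qx))
          (λ (x∈P , x∈Q) → let x∈δ , px = to ∈sep x∈P in from and (x∈δ , px , proj₂ (to ∈sep x∈Q)))
          where
          and : ∀ {x} → x ∈ sep δ (λ ξ → P ξ × Q ξ) ⇔ (x ∈ δ × P x × Q x)
          and = ∈sep ⦃ defBoth p q ⦄

    module _ {P Q R : V → Set ℓ} .⦃ p : Def {1} (λ ρ → P (proj₁ ρ)) ⦄ .⦃ q : Def {1} (λ ρ → Q (proj₁ ρ)) ⦄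
             .⦃ r : Def {1} (λ ρ → R (proj₁ ρ)) ⦄ where
      opaque
        ae-mono₂ : (∀ ξ → ξ ∈ δ → P ξ → Q ξ → R ξ) → AE P → AE Q → AE R
        ae-mono₂ h a b = ae-mono {λ ξ → P ξ × Q ξ} {R} ⦃ defBoth p q ⦄ (λ ξ ξ∈ (px , qx) → h ξ ξ∈ px qx) (ae-and a b)

    module _ {P : V → Set ℓ} .⦃ p : Def {1} (λ ρ → P (proj₁ ρ)) ⦄ where
      opaque
        ae-all : (∀ ξ → ξ ∈ δ → P ξ) → AE P
        ae-all h = upward _ _ whole (λ x x∈ → from ∈sep (x∈ , h x x∈)) (λ x x∈ → proj₁ (to ∈sep x∈))

        ae-∃ : AE P → ∃ λ ξ → ξ ∈ δ × P ξ
        ae-∃ a = byContradiction λ none → proper _ (λ z z∈ → none (z , to ∈sep z∈)) a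

        ae-ultra : AE P ⊎ AE (λ ξ → ¬ P ξ)
        ae-ultra = ultra _ _ (λ x x∈ → proj₁ (to ∈sep x∈)) λ x → mk⇔
          (λ x∈ → let x∈δ , np = to not x∈ in x∈δ , λ h → np (proj₂ (to ∈sep h)))
          (λ (x∈δ , np) → from not (x∈δ , λ px → np (from ∈sep (x∈δ , px))))
          where
          not : ∀ {x} → x ∈ sep δ (λ ξ → ¬ P ξ) ⇔ (x ∈ δ × ¬ P x)
          not = ∈sep ⦃ def¬ ⦄

        ae-¬ : ¬ AE P → AE (λ ξ → ¬ P ξ)
        ae-¬ h = Sum.[ (λ a → ⊥-elim (h a)) , id ]′ ae-ultra

        ae-absurd : AE P → AE (λ ξ → ¬ P ξ) → ⊥
        ae-absurd a b = proper (sep δ none)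
          (λ x x∈ → let _ , px , ¬px = to (∈sep ⦃ dn ⦄) x∈ in ¬px px)
          (ae-and ⦃ p ⦄ ⦃ def¬ ⦄ a b)
          where
          none : V → Set ℓ
          none ξ = P ξ × ¬ P ξ
          dn : Def {1} λ ρ → none (proj₁ ρ)
          dn = defBoth p def¬

    module _ {K : V → V → Set ℓ} .⦃ d : Def {2} (λ ρ → K (proj₁ ρ) (proj₁ (proj₂ ρ))) ⦄ where
      private instance
        dK : ∀ {n} {s t : Env n → V} → .⦃ DefTerm s ⦄ → .⦃ DefTerm t ⦄ → Def (λ ρ → K (s ρ) (t ρ))
        dK ⦃ s ⦄ ⦃ t ⦄ = defRel d s t
      private module F = Fallback tt
      opaque
        ae-complete : IsComplete U δ → ∀ {γ} → γ ∈ δ → (∀ i → i ∈ γ → AE (K i)) → AE (λ ξ → ∀ i → i ∈ γ → K i ξ)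
        ae-complete cp {γ} γ∈ h = cp γ (ƛ γ λ i → sep δ (K i)) _ γ∈ (ƛ-isFunction h) λ x → mk⇔
          (λ x∈ → let x∈δ , k = to ∈sep x∈ in x∈δ , λ ξ A r →
            let ξ∈ , A≡ = to ⟨⟩∈ƛ (to related r) in subst (x ∈_) (sym A≡) (from ∈sep (x∈δ , k ξ ξ∈)))
          (λ (x∈δ , k) → from ∈sep (x∈δ , λ i i∈ →
            proj₂ (to ∈sep (k i (sep δ (K i)) (from related (from ⟨⟩∈ƛ (i∈ , refl)))))))

    private module F = Fallback tt
    opaque
      -- A singleton in `U` would generate `U` and make it principal.
      ae-≢ : IsNonprincipal U δ → ∀ {a} → a ∈ δ → AE (λ ξ → ¬ ξ ≡ a)
      ae-≢ np {a} a∈ = ae-¬ λ h → np (a , a∈ , λ A → mk⇔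
        (λ A∈ → subsets A A∈ , byContradiction λ a∉ → ae-absurd h
          (upward A _ A∈ (λ x x∈ → from ∈sep (subsets A A∈ x x∈ , λ { refl → a∉ x∈ })) λ x x∈ → proj₁ (to ∈sep x∈)))
        (λ (A⊆ , a∈A) → upward _ A h (λ x x∈ → subst (_∈ A) (sym (proj₂ (to ∈sep x∈))) a∈A) A⊆))

  -- The ultrapower and its collapse

  opaque
    -- In Łoś's theorem `U` measures sets of coordinates given by satisfaction of a formula. For
    -- each fixed formula such a set is obtained by recursion on the syntax.
    defSat : ∀ {k n} (φ : Formula n) (v : Env k → Vec V n) → (∀ i → DefTerm (λ ρ → lookup (v ρ) i)) →
             Def (λ ρ → Sat φ (v ρ))
    defSat (i ∈̇ j) v d = def∈ ⦃ d i ⦄ ⦃ d j ⦄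
    defSat (i ≡̇ j) v d = def≡ ⦃ d i ⦄ ⦃ d j ⦄
    defSat (¬̇ φ)   v d = def¬ ⦃ defSat φ v d ⦄
    defSat (φ ∧̇ ψ) v d = defBoth (defSat φ v d) (defSat ψ v d)
    defSat (φ ∨̇ ψ) v d = def∨ ⦃ defSat φ v d ⦄ ⦃ defSat ψ v d ⦄
    defSat (φ ⇒̇ ψ) v d = defImplies (defSat φ v d) (defSat ψ v d)
    defSat (∀̇ φ)   v d = def∀ ⦃ defSat φ (λ ρ → proj₁ ρ ∷ v (proj₂ ρ)) (λ { zero → var0 ; (suc i) → weakenTerm (d i) }) ⦄
    defSat (∃̇ φ)   v d = def∃ ⦃ defSat φ (λ ρ → proj₁ ρ ∷ v (proj₂ ρ)) (λ { zero → var0 ; (suc i) → weakenTerm (d i) }) ⦄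

    castTerm : ∀ {n} {s t : Env n → V} → (∀ ρ → s ρ ≡ t ρ) → DefTerm t → DefTerm s
    castTerm e (defTerm d) = defTerm (cast (λ ρ → mk⇔ (λ h → trans h (e _)) (λ h → trans h (sym (e _)))) d)

  module Ultrapower {δ U w : V} (uf : IsUltrafilter U δ) (np : IsNonprincipal U δ) (cp : IsComplete U δ)
                    (isω : IsOmega w) (w∈δ : w ∈ δ) where
    open Ultrafilter uf public
    open Omega w isω

    Fn : V → Set ℓ
    Fn f = f ≡ ƛ δ (f ·_)

    -- Membership of f in g modulo U. The last clause makes the predecessors of g
    -- a set; it only normalises f on a set outside U.
    E : V → V → Set ℓ
    E f g = Fn f × AE (λ ξ → f · ξ ∈ g · ξ) × (∀ ξ → ξ ∈ δ → f · ξ ∈ g · ξ ⊎ f · ξ ≡ ∅)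

    module _ where
      private module F = Fallback tt
      opaque
        graphE : Def {2} (λ ρ → E (proj₁ ρ) (proj₁ (proj₂ ρ)))
        graphE = F.def∧

    open Recursion E graphE id var0 public using () renaming (val to π)
    private module R = Recursion E graphE id var0
    instance
      defπ : ∀ {n} {s : Env n → V} → .⦃ DefTerm s ⦄ → DefTerm (λ ρ → π (s ρ))
      defπ = R.defval

    instance
      defE : ∀ {n} {s t : Env n → V} → .⦃ DefTerm s ⦄ → .⦃ DefTerm t ⦄ → Def (λ ρ → E (s ρ) (t ρ))
      defE ⦃ s ⦄ ⦃ t ⦄ = defRel graphE s t

    module _ {s f₀ c : V} (f₀∈ : f₀ ∈ s) (descends : ∀ f → f ∈ s → c · f ∈ s × E (c · f) f) where
      private
        opaque
          def-c : DefTerm {1} (λ ρ → c · proj₁ ρ)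
          def-c = def· where module F = Fallback tt
        module I = Iteration f₀ (c ·_) def-c
        module F = Fallback tt
      opaque
        -- As `w ∈ δ`, completeness applies to the `w` many steps of the descent: at one coordinate
        -- `ξ` all of them are true memberships, and foundation fails there.
        no-descent : ⊥
        no-descent =
          let ξ , ξ∈ , h = ae-∃ (ae-complete {λ n ξ → I.iterate (succ n) · ξ ∈ I.iterate n · ξ} cp w∈δ λ n n∈ →
                subst (λ g → AE (λ ξ → g · ξ ∈ I.iterate n · ξ)) (sym (I.iterate-succ n∈))
                  (proj₁ (proj₂ (proj₂ (descends _ (inside n n∈))))))
              m , m∈ , min = foundation (img w λ n → I.iterate n · ξ) (_ , from ∈img (∅ , ∅∈ω , refl))
              n , n∈ , e = to ∈img m∈
          in min (I.iterate (succ n) · ξ) (subst (I.iterate (succ n) · ξ ∈_) (sym e) (h n n∈)) (from ∈img (succ n , succ∈ω n∈ , refl))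
          where
          inside : ∀ n → n ∈ w → I.iterate n ∈ s
          inside = ω-induction (subst (_∈ s) (sym I.iterate-∅) f₀∈)
            λ n n∈ h → subst (_∈ s) (sym (I.iterate-succ n∈)) (proj₁ (descends _ h))

    module _ where
      private module F = Fallback tt
      opaque
        -- `∅ ∈ T` is required because a predecessor may take the default value `∅` where it is not
        -- a member. By `support`, every function on `δ` lies in such a set, so recursion and
        -- induction reach all of them.
        wf-E : ∀ T → Trans T → ∅ ∈ T → WellFounded E (funs δ T)
        wf-E T tr ∅∈ = closed , λ s s⊆ (f₀ , f₀∈) → byContradiction λ none →
          let c , _ , C = choiceFunction {λ f g → E g f} s s λ f f∈ → byContradiction λ h →
                none (f , f∈ , λ g e g∈ → h (g , g∈ , e))
          in no-descent f₀∈ C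
          where
          closed : ∀ u v → u ∈ funs δ T → E v u → v ∈ funs δ T
          closed u v u∈ (fn , _ , h) = from ∈funs (fn , λ ξ ξ∈ →
            Sum.[ tr _ (proj₂ (to ∈funs u∈) ξ ξ∈) _ , (λ e → subst (_∈ T) (sym e) ∅∈) ]′ (h ξ ξ∈))

        support : ∀ f → Fn f → ∃ λ T → Trans T × ∅ ∈ T × f ∈ funs δ T
        support f fn =
          let T , sup , tr = transitive-superset (img δ (f ·_) ∪ pair ∅ ∅)
          in T , tr , sup _ (from ∈∪ (inj₂ (from ∈pair (inj₁ refl)))) ,
             from ∈funs (fn , λ ξ ξ∈ → sup _ (from ∈∪ (inj₁ (from ∈img (ξ , ξ∈ , refl)))))

        E-induction : {P : V → Set ℓ} → .⦃ Def {1} (λ ρ → P (proj₁ ρ)) ⦄ →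
                      (∀ f → Fn f → (∀ g → E g f → P g) → P f) → ∀ f → Fn f → P f
        E-induction {P} step f fn =
          let T , tr , ∅∈ , f∈ = support f fn
          in wf-induction {P = P} (wf-E T tr ∅∈) (λ u u∈ → step u (proj₁ (to ∈funs u∈))) f f∈

        ∈π : ∀ {f z} → Fn f → z ∈ π f ⇔ ∃ λ g → E g f × z ≡ π g
        ∈π {f} {z} fn =
          let T , tr , ∅∈ , f∈ = support f fn
              wf = wf-E T tr ∅∈
          in R.∈vals wf f∈ ⇔-∘ ≡⇒⇔ (cong (z ∈_) (R.val-unfold wf f∈))

        restrict : ∀ {f g} → AE (λ ξ → f · ξ ∈ g · ξ) → ∃ λ f′ → E f′ g × AE (λ ξ → f′ · ξ ≡ f · ξ)
        restrict {f} {g} a = f′ ,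
          (ƛ-canonical , ae-mono (λ ξ ξ∈ h → subst (_∈ g · ξ) (sym (same ξ ξ∈ h)) h) a , else) , ae-mono same a
          where
          -- The separating condition does not mention the element, so this is `f · ξ` where the
          -- membership holds and `∅` elsewhere, as the last clause of `E` asks.
          cut : V → V
          cut ξ = sep (f · ξ) λ _ → f · ξ ∈ g · ξ
          f′ : V
          f′ = ƛ δ cut
          same : ∀ ξ → ξ ∈ δ → f · ξ ∈ g · ξ → f′ · ξ ≡ f · ξ
          same ξ ξ∈ h = trans (ƛ-· ξ∈) (ext (λ z → proj₁ ∘ to ∈sep) (λ z z∈ → from ∈sep (z∈ , h)))
          else : ∀ ξ → ξ ∈ δ → f′ · ξ ∈ g · ξ ⊎ f′ · ξ ≡ ∅
          else ξ ξ∈ = Sum.map (λ h → subst (_∈ g · ξ) (sym (same ξ ξ∈ h)) h)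
            (λ ¬h → trans (ƛ-· ξ∈) (empty λ z z∈ → ¬h (proj₂ (to ∈sep z∈)))) (decide (f · ξ ∈ g · ξ))

        ae-sym : ∀ {f g} → AE (λ ξ → f · ξ ≡ g · ξ) → AE (λ ξ → g · ξ ≡ f · ξ)
        ae-sym = ae-mono λ _ _ → sym

        ae-subst∈ : ∀ {f f′ g} → AE (λ ξ → f · ξ ≡ f′ · ξ) → AE (λ ξ → f · ξ ∈ g · ξ) → AE (λ ξ → f′ · ξ ∈ g · ξ)
        ae-subst∈ = ae-mono₂ λ _ _ e → subst (_∈ _) e

        π-cong : ∀ {f g} → Fn f → Fn g → AE (λ ξ → f · ξ ≡ g · ξ) → π f ≡ π g
        π-cong fn gn = E-induction {λ f → ∀ g → Fn g → AE (λ ξ → f · ξ ≡ g · ξ) → π f ≡ π g} step _ fn _ gn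
          where
          step : ∀ f → Fn f → (∀ k → E k f → ∀ g → Fn g → AE (λ ξ → k · ξ ≡ g · ξ) → π k ≡ π g) →
                 ∀ g → Fn g → AE (λ ξ → f · ξ ≡ g · ξ) → π f ≡ π g
          step f fn IH g gn a = ext
            (λ z z∈ → let k , e , z≡ = to (∈π fn) z∈
                          k′ , e′ , b = restrict {k} {g} (ae-mono₂ (λ _ _ q → subst (_ ∈_) q) a (proj₁ (proj₂ e)))
                      in from (∈π gn) (k′ , e′ , trans z≡ (IH k e k′ (proj₁ e′) (ae-sym b))))
            (λ z z∈ → let k , e , z≡ = to (∈π gn) z∈
                          k′ , e′ , b = restrict {k} {f} (ae-mono₂ (λ _ _ q → subst (_ ∈_) (sym q)) a (proj₁ (proj₂ e)))
                      in from (∈π fn) (k′ , e′ , trans z≡ (sym (IH k′ e′ k (proj₁ e) b))))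

    module _ {K : V → V → Set ℓ} .⦃ d : Def {2} (λ ρ → K (proj₁ ρ) (proj₁ (proj₂ ρ))) ⦄ where
      private instance
        dK : ∀ {n} {s t : Env n → V} → .⦃ DefTerm s ⦄ → .⦃ DefTerm t ⦄ → Def (λ ρ → K (s ρ) (t ρ))
        dK ⦃ s ⦄ ⦃ t ⦄ = defRel d s t
      private module F = Fallback tt
      opaque
        -- The choice step of Łoś's theorem: coordinatewise witnesses become one predecessor of `g`,
        -- with `∅` on coordinates that have none.
        ae-choice : ∀ {g} → AE (λ ξ → ∃ λ x → x ∈ g · ξ × K ξ x) → ∃ λ h → E h g × AE (λ ξ → K ξ (h · ξ))
        ae-choice {g} a =
          let h , fn , H = choiceFunction {Pick} δ (⋃ (img δ (g ·_)) ∪ pair ∅ ∅) pick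
          in h , (fn , ae-mono (λ ξ ξ∈ ex → proj₁ (good ex (proj₂ (H ξ ξ∈)))) a , λ ξ ξ∈ → Sum.map proj₁ proj₂ (proj₂ (H ξ ξ∈))) ,
             ae-mono (λ ξ ξ∈ ex → proj₂ (good ex (proj₂ (H ξ ξ∈)))) a
          where
          Pick : V → V → Set ℓ
          Pick ξ x = (x ∈ g · ξ × K ξ x) ⊎ (¬ (∃ λ x → x ∈ g · ξ × K ξ x) × x ≡ ∅)
          good : ∀ {ξ x} → (∃ λ x → x ∈ g · ξ × K ξ x) → Pick ξ x → x ∈ g · ξ × K ξ x
          good _  (inj₁ h)       = h
          good ex (inj₂ (n , _)) = ⊥-elim (n ex)
          pick : ∀ ξ → ξ ∈ δ → ∃ λ x → x ∈ ⋃ (img δ (g ·_)) ∪ pair ∅ ∅ × Pick ξ x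
          pick ξ ξ∈ with decide (∃ λ x → x ∈ g · ξ × K ξ x)
          ... | inj₁ (x , x∈ , k) = x , from ∈∪ (inj₁ (from ∈⋃ (_ , from ∈img (ξ , ξ∈ , refl) , x∈))) , inj₁ (x∈ , k)
          ... | inj₂ n            = ∅ , from ∈∪ (inj₂ (from ∈pair (inj₁ refl))) , inj₂ (n , refl)

    module _ where
      private module F = Fallback tt
      opaque
        -- If `f` and `g` differ almost everywhere, the ultrafilter decides which inclusion fails
        -- almost everywhere, and a function `h` into the difference is chosen. Equality of the
        -- collapses gives an `h′` on the other side with `π h ≡ π h′`. One of `h` and `h′` precedes
        -- `f`, so the induction hypothesis identifies them almost everywhere, which is absurd.
        π-injective : ∀ {f g} → Fn f → Fn g → π f ≡ π g → AE (λ ξ → f · ξ ≡ g · ξ)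
        π-injective fn gn = E-induction {λ f → ∀ g → Fn g → π f ≡ π g → AE (λ ξ → f · ξ ≡ g · ξ)} step _ fn _ gn
          where
          step : ∀ f → Fn f → (∀ k → E k f → ∀ g → Fn g → π k ≡ π g → AE (λ ξ → k · ξ ≡ g · ξ)) →
                 ∀ g → Fn g → π f ≡ π g → AE (λ ξ → f · ξ ≡ g · ξ)
          step f fn IH g gn e = Sum.[ id , (λ ne → ⊥-elim (Sum.[ left , right ne ]′
              (ae-ultra {λ ξ → ∃ λ x → x ∈ f · ξ × ¬ x ∈ g · ξ}))) ]′ (ae-ultra {λ ξ → f · ξ ≡ g · ξ})
            where
            left : AE (λ ξ → ∃ λ x → x ∈ f · ξ × ¬ x ∈ g · ξ) → ⊥
            left a =
              let h , h∈f , h∉g = ae-choice {λ ξ x → ¬ x ∈ g · ξ} a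
                  h′ , h′∈g , e′ = to (∈π gn) (subst (π h ∈_) e (from (∈π fn) (h , h∈f , refl)))
              in ae-absurd (ae-subst∈ {g = g} (ae-sym (IH h h∈f h′ (proj₁ h′∈g) e′)) (proj₁ (proj₂ h′∈g))) h∉g
            right : AE (λ ξ → ¬ f · ξ ≡ g · ξ) → AE (λ ξ → ¬ (∃ λ x → x ∈ f · ξ × ¬ x ∈ g · ξ)) → ⊥
            right ne a =
              let h , h∈g , h∉f = ae-choice {λ ξ x → ¬ x ∈ f · ξ} (ae-mono₂ (λ ξ _ n k → byContradiction λ none → n (ext
                    (λ x x∈ → byContradiction λ x∉ → k (x , x∈ , x∉))
                    (λ x x∈ → byContradiction λ x∉ → none (x , x∈ , x∉)))) ne a)
                  h′ , h′∈f , e′ = to (∈π fn) (subst (π h ∈_) (sym e) (from (∈π gn) (h , h∈g , refl)))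
              in ae-absurd (ae-subst∈ {g = f} (IH h′ h′∈f h (proj₁ h∈g) (sym e′)) (proj₁ (proj₂ h′∈f))) h∉f

        π-∈ : ∀ {f g} → Fn f → Fn g → π f ∈ π g ⇔ AE (λ ξ → f · ξ ∈ g · ξ)
        π-∈ {f} {g} fn gn = mk⇔
          (λ h → let f′ , e , q = to (∈π gn) h
                 in ae-subst∈ {g = g} (ae-sym (π-injective fn (proj₁ e) q)) (proj₁ (proj₂ e)))
          (λ a → let f′ , e , b = restrict {f} {g} a
                 in from (∈π gn) (f′ , e , sym (π-cong (proj₁ e) fn b)))

    -- Łoś's theorem for Δ₀ formulas

    at : ∀ {n} → Vec V n → V → Vec V n
    at fs ξ = map (_· ξ) fs

    module _ where
      private module F = Fallback tt
      opaque
        defAt : ∀ {n k} (fs : Vec V n) i → DefTerm {suc k} (λ ρ → lookup (at fs (proj₁ ρ)) i)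
        defAt fs i = castTerm (λ ρ → lookup-map i (_· proj₁ ρ) fs) def·

        defSat₁ : ∀ {n} (φ : Formula n) fs → Def {1} (λ ρ → Sat φ (at fs (proj₁ ρ)))
        defSat₁ φ fs = defSat φ _ (defAt fs)

        defSat₂ : ∀ {n} (φ : Formula (suc n)) fs → Def {2} (λ ρ → Sat φ (proj₁ (proj₂ ρ) ∷ at fs (proj₁ ρ)))
        defSat₂ φ fs = defSat φ _ λ { zero → var1 ; (suc i) → defAt fs i }

        -- The left side is truth in V, not in the ultrapower. The two agree because every element
        -- of `π f` is again some `π g`, so a bounded quantifier sees only collapsed functions.
        los : ∀ {n} {φ : Formula n} → Δ₀ φ → ∀ fs → (∀ i → Fn (lookup fs i)) →
              Sat φ (map π fs) ⇔ AE (λ ξ → Sat φ (at fs ξ))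
        los (mem i j) fs fn =
          mk⇔ (ae-mono ⦃ def∈ ⦄ ⦃ defSat₁ (i ∈̇ j) fs ⦄ λ ξ _ → subst id (sym (both∈ ξ)))
              (ae-mono ⦃ defSat₁ (i ∈̇ j) fs ⦄ ⦃ def∈ ⦄ λ ξ _ → subst id (both∈ ξ))
          ⇔-∘ (π-∈ (fn i) (fn j) ⇔-∘ ≡⇒⇔ (cong₂ _∈_ (lookup-map i π fs) (lookup-map j π fs)))
          where
          both∈ : ∀ ξ → Sat (i ∈̇ j) (at fs ξ) ≡ (lookup fs i · ξ ∈ lookup fs j · ξ)
          both∈ ξ = cong₂ _∈_ (lookup-map i (_· ξ) fs) (lookup-map j (_· ξ) fs)
        los (eq i j) fs fn =
          mk⇔ (ae-mono ⦃ def≡ ⦄ ⦃ defSat₁ (i ≡̇ j) fs ⦄ λ ξ _ → subst id (sym (both≡ ξ)))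
              (ae-mono ⦃ defSat₁ (i ≡̇ j) fs ⦄ ⦃ def≡ ⦄ λ ξ _ → subst id (both≡ ξ))
          ⇔-∘ (mk⇔ (π-injective (fn i) (fn j)) (π-cong (fn i) (fn j))
          ⇔-∘ ≡⇒⇔ (cong₂ _≡_ (lookup-map i π fs) (lookup-map j π fs)))
          where
          both≡ : ∀ ξ → Sat (i ≡̇ j) (at fs ξ) ≡ (lookup fs i · ξ ≡ lookup fs j · ξ)
          both≡ ξ = cong₂ _≡_ (lookup-map i (_· ξ) fs) (lookup-map j (_· ξ) fs)
        los (neg {φ} d) fs fn = let e = los d fs fn in mk⇔
          (λ n → ae-¬ ⦃ defSat₁ φ fs ⦄ (λ a → n (from e a)))
          (λ a s → ae-absurd ⦃ defSat₁ φ fs ⦄ (to e s) a)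
        los (conj {φ} {ψ} c d) fs fn = let e = los c fs fn ; f = los d fs fn in mk⇔
          (λ (s , t) → ae-and ⦃ defSat₁ φ fs ⦄ ⦃ defSat₁ ψ fs ⦄ (to e s) (to f t))
          (λ a → from e (ae-mono ⦃ defSat₁ (φ ∧̇ ψ) fs ⦄ ⦃ defSat₁ φ fs ⦄ (λ _ _ → proj₁) a) ,
                 from f (ae-mono ⦃ defSat₁ (φ ∧̇ ψ) fs ⦄ ⦃ defSat₁ ψ fs ⦄ (λ _ _ → proj₂) a))
        los (disj {φ} {ψ} c d) fs fn = let e = los c fs fn ; f = los d fs fn in mk⇔
          Sum.[ ae-mono ⦃ defSat₁ φ fs ⦄ ⦃ defSat₁ (φ ∨̇ ψ) fs ⦄ (λ _ _ → inj₁) ∘ to e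
              , ae-mono ⦃ defSat₁ ψ fs ⦄ ⦃ defSat₁ (φ ∨̇ ψ) fs ⦄ (λ _ _ → inj₂) ∘ to f ]′
          (λ a → Sum.map (from e) (λ n → from f (ae-mono₂ ⦃ defSat₁ (φ ∨̇ ψ) fs ⦄ ⦃ defSat₁ (¬̇ φ) fs ⦄ ⦃ defSat₁ ψ fs ⦄
              (λ _ _ → λ { (inj₁ s) n → ⊥-elim (n s) ; (inj₂ t) _ → t }) a n))
            (ae-ultra ⦃ defSat₁ φ fs ⦄))
        los (impl {φ} {ψ} c d) fs fn = let e = los c fs fn ; f = los d fs fn in mk⇔
          (λ k → Sum.[ (λ a → ae-mono ⦃ defSat₁ ψ fs ⦄ ⦃ defSat₁ (φ ⇒̇ ψ) fs ⦄ (λ _ _ t _ → t) (to f (k (from e a))))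
                     , ae-mono ⦃ defSat₁ (¬̇ φ) fs ⦄ ⦃ defSat₁ (φ ⇒̇ ψ) fs ⦄ (λ _ _ n s → ⊥-elim (n s)) ]′
            (ae-ultra ⦃ defSat₁ φ fs ⦄))
          (λ a s → from f (ae-mono₂ ⦃ defSat₁ (φ ⇒̇ ψ) fs ⦄ ⦃ defSat₁ φ fs ⦄ ⦃ defSat₁ ψ fs ⦄ (λ _ _ k → k) a (to e s)))
        los (ball i {φ} d) fs fn = mk⇔
          (λ s → byContradiction λ na →
            -- If the bounded statement fails almost everywhere, the chosen counterexamples form a
            -- function whose collapse is a counterexample.
            let h , h∈ , n = ae-choice {λ ξ x → ¬ Sat φ (x ∷ at fs ξ)} ⦃ def¬ ⦃ defSat₂ φ fs ⦄ ⦄ {lookup fs i}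
                  (ae-mono ⦃ defSat₁ (¬̇ (∀̇ (zero ∈̇ suc i ⇒̇ φ))) fs ⦄
                    ⦃ def∃ ⦃ defBoth (def∈ ⦃ var0 ⦄ ⦃ def· ⦄) (def¬ ⦃ defSwap ⦄) ⦄ ⦄
                    (λ ξ _ k → byContradiction λ none → k λ x x∈ → byContradiction λ ns →
                      none (x , subst (x ∈_) (lookup-map i (_· ξ) fs) x∈ , ns))
                    (ae-¬ ⦃ defSat₁ (∀̇ (zero ∈̇ suc i ⇒̇ φ)) fs ⦄ na))
                IH = los d (h ∷ fs) λ { zero → proj₁ h∈ ; (suc j) → fn j }
            in ae-absurd ⦃ defSat₁ φ (h ∷ fs) ⦄ (to IH (s (π h)
                 (subst (π h ∈_) (sym (lookup-map i π fs)) (from (∈π (fn i)) (h , h∈ , refl))))) n)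
          (λ a x x∈ →
            let h , h∈ , x≡ = to (∈π (fn i)) (subst (x ∈_) (lookup-map i π fs) x∈)
                IH = los d (h ∷ fs) λ { zero → proj₁ h∈ ; (suc j) → fn j }
            in subst (λ x → Sat φ (x ∷ map π fs)) (sym x≡) (from IH
                 (ae-mono₂ ⦃ defSat₁ (∀̇ (zero ∈̇ suc i ⇒̇ φ)) fs ⦄ ⦃ def∈ ⦄ ⦃ defSat₁ φ (h ∷ fs) ⦄
                   (λ ξ _ k m → k (h · ξ) (subst (h · ξ ∈_) (sym (lookup-map i (_· ξ) fs)) m)) a (proj₁ (proj₂ h∈)))))
          where
          defSwap : Def {2} (λ ρ → Sat φ (proj₁ ρ ∷ at fs (proj₁ (proj₂ ρ))))
          defSwap = defRel (defSat₂ φ fs) var1 var0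
        los (bex i {φ} d) fs fn = mk⇔
          (λ (x , x∈ , s) →
            let h , h∈ , x≡ = to (∈π (fn i)) (subst (x ∈_) (lookup-map i π fs) x∈)
                IH = los d (h ∷ fs) λ { zero → proj₁ h∈ ; (suc j) → fn j }
            in ae-mono₂ ⦃ def∈ ⦄ ⦃ defSat₁ φ (h ∷ fs) ⦄ ⦃ defSat₁ (∃̇ (zero ∈̇ suc i ∧̇ φ)) fs ⦄
                 (λ ξ _ m t → h · ξ , subst (h · ξ ∈_) (sym (lookup-map i (_· ξ) fs)) m , t)
                 (proj₁ (proj₂ h∈)) (to IH (subst (λ x → Sat φ (x ∷ map π fs)) x≡ s)))
          (λ a →
            let h , h∈ , k = ae-choice {λ ξ x → Sat φ (x ∷ at fs ξ)} ⦃ defSat₂ φ fs ⦄ {lookup fs i}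
                  (ae-mono ⦃ defSat₁ (∃̇ (zero ∈̇ suc i ∧̇ φ)) fs ⦄
                    ⦃ def∃ ⦃ defBoth (def∈ ⦃ var0 ⦄ ⦃ def· ⦄) defSwap ⦄ ⦄
                    (λ ξ _ (x , x∈ , s) → x , subst (x ∈_) (lookup-map i (_· ξ) fs) x∈ , s) a)
                IH = los d (h ∷ fs) λ { zero → proj₁ h∈ ; (suc j) → fn j }
            in π h , subst (π h ∈_) (sym (lookup-map i π fs)) (from (∈π (fn i)) (h , h∈ , refl)) , from IH k)
          where
          defSwap : Def {2} (λ ρ → Sat φ (proj₁ ρ ∷ at fs (proj₁ (proj₂ ρ))))
          defSwap = defRel (defSat₂ φ fs) var1 var0

    -- The embedding `j`

    const : V → V
    const x = ƛ δ λ _ → x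

    j : V → V
    j x = π (const x)

    module _ where
      private module F = Fallback tt
      opaque
        const-Fn : ∀ {x} → Fn (const x)
        const-Fn = ƛ-canonical

        const-· : ∀ {x ξ} → ξ ∈ δ → const x · ξ ≡ x
        const-· ξ∈ = ƛ-· ξ∈

        j-Σ₁ : ∀ {n} {φ : Formula n} → Σ₁ φ → ∀ xs → Sat φ xs → Sat φ (map j xs)
        j-Σ₁ (delta₀ {φ} d) xs s = subst (Sat φ) (sym (map-∘ π const xs))
          (from (los d (map const xs) fn) (ae-all ⦃ defSat₁ φ (map const xs) ⦄ λ ξ ξ∈ → subst (Sat φ) (sym (values ξ ξ∈)) s))
          where
          fn : ∀ i → Fn (lookup (map const xs) i)
          fn i = subst Fn (sym (lookup-map i const xs)) const-Fn
          values : ∀ ξ → ξ ∈ δ → at (map const xs) ξ ≡ xs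
          values ξ ξ∈ = trans (sym (map-∘ (_· ξ) const xs)) (trans (map-cong (λ x → const-· ξ∈) xs) (map-id xs))
        j-Σ₁ (exists σ) xs (x , s) = j x , j-Σ₁ σ (x ∷ xs) s

    module _ where
      private module F = Fallback tt
      opaque
        π-Trans : ∀ {f} → Fn f → AE (λ ξ → Trans (f · ξ)) → Trans (π f)
        π-Trans {f} fn t x x∈ z z∈ =
          let h , h∈ , x≡ = to (∈π fn) x∈
              k , k∈ , z≡ = to (∈π (proj₁ h∈)) (subst (z ∈_) x≡ z∈)
              k∈f = ae-mono₂ {λ ξ → Trans (f · ξ) × h · ξ ∈ f · ξ} (λ ξ _ (t , p) q → t (h · ξ) p (k · ξ) q)
                      (ae-and t (proj₁ (proj₂ h∈))) (proj₁ (proj₂ k∈))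
          in subst (_∈ π f) (sym z≡) (from (π-∈ (proj₁ k∈) fn) k∈f)

        π-Ord : ∀ {f} → Fn f → AE (λ ξ → Ord (f · ξ)) → Ord (π f)
        π-Ord {f} fn o = π-Trans fn (ae-mono (λ _ _ → proj₁) o) , λ x x∈ →
          let h , h∈ , x≡ = to (∈π fn) x∈
          in subst Trans (sym x≡) (π-Trans (proj₁ h∈) (ae-mono₂ (λ ξ _ o p → proj₂ o (h · ξ) p) o (proj₁ (proj₂ h∈))))

        j-Ord : ∀ {α} → Ord α → Ord (j α)
        j-Ord o = π-Ord const-Fn (ae-all λ ξ ξ∈ → subst Ord (sym (const-· ξ∈)) o)

        π∈j : ∀ {f x} → Fn f → π f ∈ j x ⇔ AE (λ ξ → f · ξ ∈ x)
        π∈j {f} {x} fn = mk⇔ (ae-mono λ ξ ξ∈ → subst (f · ξ ∈_) (const-· ξ∈))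
                             (ae-mono λ ξ ξ∈ → subst (f · ξ ∈_) (sym (const-· ξ∈))) ⇔-∘ π-∈ fn const-Fn

        j-∈ : ∀ {x y} → x ∈ y → j x ∈ j y
        j-∈ {x} {y} h = from (π∈j const-Fn) (ae-all λ ξ ξ∈ → subst (_∈ y) (sym (const-· ξ∈)) h)

        -- For `γ ∈ α` the induction hypothesis gives `γ ≤ j γ`, and `j γ ∈ j α`.
        ⊆j : ∀ α → Ord α → α ⊆ j α
        ⊆j = ord-induction λ α o IH γ γ∈ →
          Sum.[ proj₁ (j-Ord o) (j γ) (j-∈ γ∈) γ , (λ e → subst (_∈ j α) (sym e) (j-∈ γ∈)) ]′
            (ord-⊆ (Ord-∈ o γ∈) (j-Ord (Ord-∈ o γ∈)) (IH γ γ∈))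

        ∅∈ordinal : ∀ {α x} → Ord α → x ∈ α → ∅ ∈ α
        ∅∈ordinal {α} {x} o x∈ with ord-total ∅ ((λ _ h → ⊥-elim (∉∅ h)) , λ _ h → ⊥-elim (∉∅ h)) α o
        ... | inj₁ h           = h
        ... | inj₂ (inj₁ refl) = ⊥-elim (∉∅ x∈)
        ... | inj₂ (inj₂ h)    = ⊥-elim (∉∅ h)

        -- One inclusion is `⊆j`. An element of `j κ` is some `π β` with values of `β` in `κ` or
        -- equal to the default `∅`; the element `x` of `κ` guarantees that `∅` is in `κ` too.
        j-fixed : ∀ {κ x} → Ord κ → x ∈ κ → (∀ β → Fn β → (∀ ξ → ξ ∈ δ → β · ξ ∈ κ) → π β ∈ κ) → j κ ≡ κ
        j-fixed {κ} o x∈ h = ext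
          (λ z z∈ → let β , β∈ , z≡ = to (∈π const-Fn) z∈
                    in subst (_∈ κ) (sym z≡) (h β (proj₁ β∈) λ ξ ξ∈ →
                         Sum.[ subst (β · ξ ∈_) (const-· ξ∈) , (λ e → subst (_∈ κ) (sym e) (∅∈ordinal o x∈)) ]′
                           (proj₂ (proj₂ β∈) ξ ξ∈)))
          (⊆j κ o)

      -- The fixed points `ν` and `ν⁺`

      module _ {ν : V} (cν : IsCardinal ν) (δ∈ν : δ ∈ ν) (inacc : IsInaccessibleFor δ ν)
               (¬cof : ¬ IsCofinality δ ν) where

        private
          oν : Ord ν
          oν = IsOrdinal⇒Ord (proj₁ cν)

        opaque
          -- Otherwise `δ` would be the cofinality of `ν`. The map `β` itself would be cofinal; and
          -- for a cofinal `h` on a smaller `γ`, completeness would give one `ξ` with `β · ξ` above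
          -- every `h · i`.
          bounded : ∀ β → Fn β → (∀ ξ → ξ ∈ δ → β · ξ ∈ ν) → ∃ λ a → a ∈ ν × AE (λ ξ → β · ξ ⊆ a)
          bounded β fn into = byContradiction λ none → ¬cof
            ( Ord⇒IsOrdinal (Ord-∈ oν δ∈ν)
            , (β , canonical-isFunction fn into , λ α α∈ → byContradiction λ ncof → none (α , α∈ ,
                ae-all λ ξ ξ∈ → ∉⇒⊇ (Ord-∈ oν α∈) (Ord-∈ oν (into ξ ξ∈)) λ h →
                  ncof (ξ , β · ξ , from related (subst (⟨ ξ , β · ξ ⟩ ∈_) (sym fn) (from ⟨⟩∈ƛ (ξ∈ , refl))) , inj₁ h)))
            , λ γ γ∈ (h , F , cof) →
                let ξ , ξ∈ , k = ae-∃ (ae-complete {λ i ξ → ¬ β · ξ ⊆ h · i} cp γ∈ λ i i∈ →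
                                   ae-¬ λ a → none (h · i , proj₁ (isFunction-apply F i∈) , a))
                    i , b , r , le = cof (β · ξ) (into ξ ξ∈)
                    i∈ , b≡ = isFunction-graph F (to related r)
                in k i i∈ (subst (β · ξ ⊆_) b≡ (≤⇒⊆ (Ord-∈ oν (subst (_∈ ν) (sym b≡) (proj₁ (isFunction-apply F i∈)))) le)) )

          -- Suppose the ordinal `π β` includes `ν`. Each element of `ν` is then the collapse of a
          -- function that lies below a bound `a ∈ ν` almost everywhere. Through a bijection `e`
          -- from the cardinal `l` of `a`, such functions are coded by functions from `δ` to `l`, of
          -- which there are `μ ∈ ν`; so `ν` would inject into `μ`.
          π∈ν : ∀ β → Fn β → (∀ ξ → ξ ∈ δ → β · ξ ∈ ν) → π β ∈ ν
          π∈ν β fn into = byContradiction λ πβ∉ν → absurd (∉⇒⊇ oπβ oν πβ∉ν)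
            where
            oπβ : Ord (π β)
            oπβ = π-Ord fn (ae-all λ ξ ξ∈ → Ord-∈ oν (into ξ ξ∈))
            absurd : ν ⊆ π β → ⊥
            absurd ν⊆ =
              let a , a∈ν , bound = bounded β fn into
                  l , cl , ol , l∈ , a~l = cardinal-≤ a (Ord-∈ oν a∈ν) equinumerous-refl
                  l∈ν = Sum.[ proj₁ oν a a∈ν l , (λ e → subst (_∈ ν) (sym e) a∈ν) ]′ (to ∈succ l∈)
                  μ , (cμ , funs , isfuns , b , bij-b) , μ∈ν = inacc l cl l∈ν
                  e , bij-e = equinumerous-sym a~l
              in count a l μ funs b e bound isfuns bij-b bij-e μ∈ν
              where
              count : ∀ a l μ funs b e → AE (λ ξ → β · ξ ⊆ a) → (∀ f → f ∈ funs ⇔ IsFunction f δ l) →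
                      IsBijection b funs μ → IsBijection e l a → μ ∈ ν → ⊥
              count a l μ funs b e bound isfuns bij-b bij-e μ∈ν = cardinal-no-injection {K} cν μ∈ν total
                λ { x x′ y _ _ y∈ (f , f∈ , p , x≡) (f′ , f′∈ , p′ , x′≡) →
                  trans x≡ (trans (cong (λ f → π (ƛ δ λ ξ → e · (f · ξ))) (B.injective f f′ y f∈ f′∈ y∈ p p′)) (sym x′≡)) }
                where
                module B = Bijection (bijection-graph bij-b)
                module E′ = Bijection (bijection-graph bij-e)
                K : V → V → Set ℓ
                K x i = ∃ λ f → f ∈ funs × ⟨ f , i ⟩ ∈ b × x ≡ π (ƛ δ λ ξ → e · (f · ξ))
                preimage : ∀ {y} → y ∈ a → ∃ λ i → i ∈ l × e · i ≡ y
                preimage y∈ = let i , i∈ , p = E′.surjective _ y∈ in i , i∈ , sym (proj₂ (isFunction-graph (proj₁ bij-e) p))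
                total : ∀ x → x ∈ ν → ∃ λ i → i ∈ μ × K x i
                total x x∈ =
                  let g , g∈ , x≡ = to (∈π fn) (ν⊆ x x∈)
                      inside = ae-mono₂ {R = λ ξ → g · ξ ∈ a} (λ ξ _ s p → s (g · ξ) p) bound (proj₁ (proj₂ g∈))
                      -- Some coordinate has its value in `a`, so `l` has an element `i₀`, the
                      -- default index where `g` leaves `a`.
                      ξ₀ , _ , p₀ = ae-∃ inside
                      i₀ , i₀∈ , _ = preimage p₀
                      f , fnf , Hf = choiceFunction {λ ξ i → g · ξ ∈ a → e · i ≡ g · ξ} δ l λ ξ ξ∈ →
                        Sum.[ (λ h → let i , i∈ , q = preimage h in i , i∈ , λ _ → q)
                            , (λ n → i₀ , i₀∈ , λ h → ⊥-elim (n h)) ]′ (decide (g · ξ ∈ a))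
                      f∈ = from (isfuns f) (canonical-isFunction fnf λ ξ ξ∈ → proj₁ (Hf ξ ξ∈))
                      i , i∈ , p = B.total f f∈
                  in i , i∈ , f , f∈ , p , trans x≡ (π-cong (proj₁ g∈) ƛ-canonical (ae-mono
                       (λ ξ ξ∈ h → trans (sym (proj₂ (Hf ξ ξ∈) h)) (sym (ƛ-· ξ∈))) inside))

          j-ν : j ν ≡ ν
          j-ν = j-fixed oν δ∈ν π∈ν

        module _ {ν⁺ : V} (s : IsSuccessorCardinal ν⁺ ν) where

          private
            oν⁺ : Ord ν⁺
            oν⁺ = IsOrdinal⇒Ord (proj₁ (proj₁ s))
            ν∈ν⁺ : ν ∈ ν⁺
            ν∈ν⁺ = proj₁ (proj₂ s)

          opaque
            -- The cardinal of `α` is at most `ν`. The bound `𝒫 (prod ν⁺ ν)` is the same for all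
            -- `α`, which allows choosing an injection for every coordinate at once.
            injects : ∀ {α} → α ∈ ν⁺ → ∃ λ e → e ∈ 𝒫 (prod ν⁺ ν) × (∀ x → x ∈ α → e · x ∈ ν) ×
                      (∀ x x′ → x ∈ α → x′ ∈ α → e · x ≡ e · x′ → x ≡ x′)
            injects {α} α∈ =
              let l , cl , ol , l∈ , e , bij-e = cardinal-≤ α (Ord-∈ oν⁺ α∈) equinumerous-refl
                  l∈ν⁺ = Sum.[ proj₁ oν⁺ α α∈ l , (λ q → subst (_∈ ν⁺) (sym q) α∈) ]′ (to ∈succ l∈)
                  l⊆ν  = ∉⇒⊇ oν ol λ ν∈l → Sum.[ ∈-asym l∈ν⁺ , (λ q → ∈-irrefl (subst (l ∈_) q l∈ν⁺)) ]′ (proj₂ (proj₂ s) l cl ν∈l)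
                  F = proj₁ bij-e
                  open Bijection (bijection-graph bij-e)
              in e ,
                 from ∈𝒫 (λ p p∈ → let x , y , x∈ , y∈ , o = proj₁ F p p∈
                                   in from ∈prod (x , proj₁ oν⁺ α α∈ x x∈ , y , l⊆ν y y∈ , to isOrderedPair o)) ,
                 (λ x x∈ → l⊆ν _ (proj₁ (isFunction-apply F x∈))) ,
                 λ x x′ x∈ x′∈ q → injective x x′ (e · x) x∈ x′∈ (proj₁ (isFunction-apply F x∈)) (proj₂ (isFunction-apply F x∈))
                   (subst (λ y → ⟨ x′ , y ⟩ ∈ e) (sym q) (proj₂ (isFunction-apply F x′∈)))

            -- With injections `e · ξ` from `β · ξ` to `ν`, sending `π g` to `π (compose g)` injects
            -- `π β` into `j ν`, which is `ν`. So `π β` cannot include `ν⁺`.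
            π∈ν⁺ : ∀ β → Fn β → (∀ ξ → ξ ∈ δ → β · ξ ∈ ν⁺) → π β ∈ ν⁺
            π∈ν⁺ β fn into = byContradiction λ πβ∉ν⁺ → absurd (∉⇒⊇ oπβ oν⁺ πβ∉ν⁺)
              where
              oπβ : Ord (π β)
              oπβ = π-Ord fn (ae-all λ ξ ξ∈ → Ord-∈ oν⁺ (into ξ ξ∈))
              Injects : V → V → Set ℓ
              Injects ξ e = (∀ x → x ∈ β · ξ → e · x ∈ ν) × (∀ x x′ → x ∈ β · ξ → x′ ∈ β · ξ → e · x ≡ e · x′ → x ≡ x′)
              absurd : ν⁺ ⊆ π β → ⊥
              absurd ν⁺⊆ =
                let e , _ , H = choiceFunction {Injects} δ (𝒫 (prod ν⁺ ν)) λ ξ ξ∈ → injects (into ξ ξ∈)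
                in contra e λ ξ ξ∈ → proj₂ (H ξ ξ∈)
                where
                contra : ∀ e → (∀ ξ → ξ ∈ δ → Injects ξ (e · ξ)) → ⊥
                contra e H = cardinal-no-injection {K} (proj₁ s) ν∈ν⁺ total
                  λ { x x′ y _ _ _ (g , g∈ , x≡ , y≡) (g′ , g′∈ , x′≡ , y≡′) → trans x≡ (trans
                    (π-cong (proj₁ g∈) (proj₁ g′∈) (ae-mono₂ {λ ξ → g · ξ ∈ β · ξ × g′ · ξ ∈ β · ξ}
                      (λ ξ ξ∈ (p , p′) q → proj₂ (H ξ ξ∈) _ _ p p′ (trans (sym (ƛ-· ξ∈)) (trans q (ƛ-· ξ∈))))
                      (ae-and (proj₁ (proj₂ g∈)) (proj₁ (proj₂ g′∈)))
                      (π-injective {compose g} {compose g′} ƛ-canonical ƛ-canonical (trans (sym y≡) y≡′)))) (sym x′≡)) }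
                  where
                  compose : V → V
                  compose g = ƛ δ λ ξ → e · ξ · (g · ξ)
                  K : V → V → Set ℓ
                  K x y = ∃ λ g → E g β × x ≡ π g × y ≡ π (compose g)
                  total : ∀ x → x ∈ ν⁺ → ∃ λ y → y ∈ ν × K x y
                  total x x∈ =
                    let g , g∈ , x≡ = to (∈π fn) (ν⁺⊆ x x∈)
                    in π (compose g) ,
                       subst (π (compose g) ∈_) j-ν (from (π∈j ƛ-canonical) (ae-mono
                         (λ ξ ξ∈ p → subst (_∈ ν) (sym (ƛ-· ξ∈)) (proj₁ (H ξ ξ∈) _ p)) (proj₁ (proj₂ g∈)))) ,
                       g , g∈ , x≡ , refl

            j-ν⁺ : j ν⁺ ≡ ν⁺
            j-ν⁺ = j-fixed oν⁺ ν∈ν⁺ π∈ν⁺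

  -- The contradiction

  module Contradiction {δ U w : V} (uf : IsUltrafilter U δ) (np : IsNonprincipal U δ) (cp : IsComplete U δ)
                       (isω : IsOmega w) (w∈δ : w ∈ δ) (cδ : IsCardinal δ)
                       {ν κ : V} (δ∈ν : δ ∈ ν) (inacc : IsInaccessibleFor δ ν)
                       (cκ : IsCardinal κ) (ν≤κ : ν ≤ κ) where
    open Ultrapower uf np cp isω w∈δ
    open Omega w isω using (∅∈ω)

    private
      oκ : Ord κ
      oκ = IsOrdinal⇒Ord (proj₁ cκ)
      oδ : Ord δ
      oδ = IsOrdinal⇒Ord (proj₁ cδ)
      ν⊆κ : ν ⊆ κ
      ν⊆κ = ≤⇒⊆ oκ ν≤κ

    -- Membership in the class `M`.
    Representable : V → Set ℓ
    Representable x = ∃ λ f → Fn f × x ≡ π f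

    A : V
    A = img κ j

    -- If A = π y then every g with g ξ ∈ y ξ almost everywhere is constant almost
    -- everywhere. But κ > |δ^δ|, so δ many α share the same set {ξ ∣ α ∈ y ξ}.
    module _ {y : V} (fn : Fn y) (πy : π y ≡ A) where
      B : V → V
      B u = sep δ λ ξ → u ∈ y · ξ

      _≺_ : V → V → Set ℓ
      v ≺ u = v ∈ κ × u ∈ κ × v ∈ u × B v ≡ B u

      module _ where
        private module F = Fallback tt
        opaque
          def≺ : Def {2} (λ ρ → proj₁ ρ ≺ proj₁ (proj₂ ρ))
          def≺ = F.def∧

      -- the position of u among the v ∈ κ with B v = B u
      open Recursion _≺_ def≺ id var0 using () renaming (val to position)
      -- the values v of a function that codes both B α and position α
      Codes : V → V → V → Set ℓ
      Codes α ξ v = (α ∈ y · ξ → v ≡ position α) × (¬ α ∈ y · ξ → ¬ v ≡ position α)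

      private
        module R = Recursion _≺_ def≺ id var0
        instance
          defPosition : ∀ {n} {s : Env n → V} → .⦃ DefTerm s ⦄ → DefTerm (λ ρ → position (s ρ))
          defPosition = R.defval
          def≺′ : ∀ {n} {s t : Env n → V} → .⦃ DefTerm s ⦄ → .⦃ DefTerm t ⦄ → Def (λ ρ → s ρ ≺ t ρ)
          def≺′ ⦃ s ⦄ ⦃ t ⦄ = defRel def≺ s t
        module F = Fallback tt

      opaque
        wf-≺ : WellFounded _≺_ κ
        wf-≺ = (λ _ _ _ → proj₁) , λ s _ ne →
          let m , m∈ , h = foundation s ne in m , m∈ , λ v v≺ → h v (proj₁ (proj₂ (proj₂ v≺)))

        ∈position : ∀ {u z} → u ∈ κ → z ∈ position u ⇔ ∃ λ v → v ≺ u × z ≡ position v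
        ∈position {z = z} u∈ = R.∈vals wf-≺ u∈ ⇔-∘ ≡⇒⇔ (cong (z ∈_) (R.val-unfold wf-≺ u∈))

        position-Ord : ∀ {u} → u ∈ κ → Ord (position u)
        position-Ord u∈ = position-Trans u∈ , λ x x∈ →
          let v , v≺ , x≡ = to (∈position u∈) x∈ in subst Trans (sym x≡) (position-Trans (proj₁ v≺))
          where
          position-Trans : ∀ {u} → u ∈ κ → Trans (position u)
          position-Trans {u} u∈ x x∈ z z∈ =
            let v , (v∈ , _ , v∈u , Bv) , x≡ = to (∈position u∈) x∈
                v′ , (v′∈ , _ , v′∈v , Bv′) , z≡ = to (∈position v∈) (subst (z ∈_) x≡ z∈)
            in from (∈position u∈) (v′ , (v′∈ , u∈ , proj₂ oκ u u∈ v v∈u v′ v′∈v , trans Bv′ Bv) , z≡)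

        position-injective : ∀ {u v} → u ∈ κ → v ∈ κ → B u ≡ B v → position u ≡ position v → u ≡ v
        position-injective {u} {v} u∈ v∈ b p with ord-total u (Ord-∈ oκ u∈) v (Ord-∈ oκ v∈)
        ... | inj₁ h        = ⊥-elim (∈-irrefl (subst (position u ∈_) (sym p) (from (∈position v∈) (u , (u∈ , v∈ , h , b) , refl))))
        ... | inj₂ (inj₁ h) = h
        ... | inj₂ (inj₂ h) = ⊥-elim (∈-irrefl (subst (position v ∈_) p (from (∈position u∈) (v , (v∈ , u∈ , h , sym b) , refl))))

        ae-B : ∀ {α} → α ∈ κ → AE (λ ξ → α ∈ y · ξ)
        ae-B {α} α∈ = ae-mono (λ ξ ξ∈ → subst (_∈ y · ξ) (const-· ξ∈))
          (to (π-∈ const-Fn fn) (subst (j α ∈_) (sym πy) (from ∈img (α , α∈ , refl))))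

        -- Here `π g ∈ A`, so `π g` is some `j α` and `g` takes the value `α` on a set in `U`. By
        -- nonprincipality that set has two points.
        no-injective-selection : ∀ {g} → Fn g → AE (λ ξ → g · ξ ∈ y · ξ) →
                                 (∀ ξ ξ′ → ξ ∈ δ → ξ′ ∈ δ → g · ξ ≡ g · ξ′ → ξ ≡ ξ′) → ⊥
        no-injective-selection {g} gn a inj = absurd (to ∈img (subst (π g ∈_) πy (from (π-∈ gn fn) a)))
          where
          absurd : (∃ λ α → α ∈ κ × π g ≡ j α) → ⊥
          absurd (α , _ , e) =
            let b = ae-mono {Q = λ ξ → g · ξ ≡ α} (λ ξ ξ∈ q → trans q (const-· ξ∈)) (π-injective gn const-Fn e)
                ξ , ξ∈ , p = ae-∃ b
                ξ′ , ξ′∈ , p′ , ne = ae-∃ (ae-and b (ae-≢ np ξ∈))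
            in ne (inj ξ′ ξ ξ′∈ ξ∈ (trans p′ (sym p)))

        -- If `position α` included `δ`, each `ξ ∈ δ` would be the position of some `v ≺ α`. As
        -- `B v ≡ B α`, this `v` lies in `y · ξ` for every `ξ` in `B α`, hence almost everywhere,
        -- and distinct positions make the selection injective.
        position-small : ∀ α → α ∈ κ → position α ∈ δ
        position-small α α∈ = byContradiction λ n →
          let δ⊆ = ∉⇒⊇ (position-Ord α∈) oδ n
              g , gn , H = choiceFunction {λ ξ v → v ≺ α × ξ ≡ position v} δ κ λ ξ ξ∈ →
                let v , v≺ , e = to (∈position α∈) (δ⊆ ξ ξ∈) in v , proj₁ v≺ , v≺ , e
          in no-injective-selection gn
               (ae-mono (λ ξ ξ∈ p → proj₂ (to ∈sep (subst (ξ ∈_) (sym (proj₂ (proj₂ (proj₂ (proj₁ (proj₂ (H ξ ξ∈)))))))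
                 (from ∈sep (ξ∈ , p))))) (ae-B α∈))
               λ ξ ξ′ ξ∈ ξ′∈ q → trans (proj₂ (proj₂ (H ξ ξ∈))) (trans (cong position q) (sym (proj₂ (proj₂ (H ξ′ ξ′∈)))))

        -- Supplies the value of a code off `B α`, where it must differ from `position α`; `∅` and
        -- `w` are two elements of `δ` to pick from.
        other : ∀ x → ∃ λ q → q ∈ δ × ¬ q ≡ x
        other x with decide (∅ ≡ x)
        ... | inj₁ refl = w , w∈δ , λ e → ∉∅ (subst (∅ ∈_) e ∅∈ω)
        ... | inj₂ n    = ∅ , ∅∈ordinal oδ w∈δ , n

        same-B : ∀ α β f → position α ≡ position β → (∀ ξ → ξ ∈ δ → Codes α ξ (f · ξ)) →
                 (∀ ξ → ξ ∈ δ → Codes β ξ (f · ξ)) → B α ⊆ B β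
        same-B α β f e c c′ ξ ξ∈B =
          let ξ∈ , h = to ∈sep ξ∈B
          in from ∈sep (ξ∈ , byContradiction λ n → proj₂ (c′ ξ ξ∈) n (trans (proj₁ (c ξ ξ∈) h) e))

        defCodes : ∀ α → Def {2} (λ ρ → Codes α (proj₁ ρ) (proj₁ (proj₂ ρ)))
        defCodes α = F.def∧

        code-value : ∀ α → α ∈ κ → ∀ ξ → ξ ∈ δ → ∃ λ v → v ∈ δ × Codes α ξ v
        code-value α α∈ ξ ξ∈ with decide (α ∈ y · ξ)
        ... | inj₁ h = position α , position-small α α∈ , (λ _ → refl) , λ n → ⊥-elim (n h)
        ... | inj₂ n = let q , q∈ , q≢ = other (position α) in q , q∈ , (λ h → ⊥-elim (n h)) , λ _ → q≢

        code : ∀ α → α ∈ κ → ∃ λ f → f ≡ ƛ δ (f ·_) × (∀ ξ → ξ ∈ δ → f · ξ ∈ δ × Codes α ξ (f · ξ))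
        code α α∈ = choiceFunction {Codes α} ⦃ defCodes α ⦄ δ δ (code-value α α∈)

        -- A function from `δ` to `δ` codes at most one `α`. Inaccessibility, applied to `δ` itself,
        -- gives only `μ ∈ ν` such functions, while every `α ∈ κ` has a code.
        A-not-π : ⊥
        A-not-π =
          let μ , (_ , funs , isfuns , b , bij) , μ∈ν = inacc δ cδ δ∈ν
          in count μ funs b isfuns bij (ν⊆κ μ μ∈ν)
          where
          count : ∀ μ funs b → (∀ f → f ∈ funs ⇔ IsFunction f δ δ) → IsBijection b funs μ → μ ∈ κ → ⊥
          count μ funs b isfuns bij μ∈ = cardinal-no-injection {K} cκ μ∈ total injective
            where
            module P = Bijection (bijection-graph bij)
            K : V → V → Set ℓ
            K α i = ∃ λ f → f ∈ funs × ⟨ f , i ⟩ ∈ b × (∀ ξ → ξ ∈ δ → Codes α ξ (f · ξ))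
            total : ∀ α → α ∈ κ → ∃ λ i → i ∈ μ × K α i
            total α α∈ =
              let f , fn , H = code α α∈
                  f∈ = from (isfuns f) (canonical-isFunction fn λ ξ ξ∈ → proj₁ (H ξ ξ∈))
                  i , i∈ , p = P.total f f∈
              in i , i∈ , f , f∈ , p , λ ξ ξ∈ → proj₂ (H ξ ξ∈)
            injective : ∀ α β i → α ∈ κ → β ∈ κ → i ∈ μ → K α i → K β i → α ≡ β
            injective α β i α∈ β∈ i∈ (f , f∈ , p , c) (f′ , f′∈ , p′ , c″) =
              let c′ = subst (λ f → ∀ ξ → ξ ∈ δ → Codes β ξ (f · ξ)) (P.injective f′ f i f′∈ f∈ i∈ p′ p) c″
                  -- Both `B α` and `B β` are in `U`, so they meet. At a common point the shared
                  -- code has both positions as its value; once the positions agree, so do `B α` and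
                  -- `B β`.
                  ξ , ξ∈ , h , h′ = ae-∃ (ae-and (ae-B α∈) (ae-B β∈))
                  e = trans (sym (proj₁ (c ξ ξ∈) h)) (proj₁ (c′ ξ ξ∈) h′)
              in position-injective α∈ β∈ (ext {B α} {B β} (same-B α β f e c c′) (same-B β α f (sym e) c′ c)) e

    -- The set `A` and its complement in `κ`

    module _ (jκ : j κ ≡ κ) where
      private module F = Fallback tt

      A′ : V
      A′ = sep κ λ x → ¬ x ∈ A

      opaque
        A⊆κ : A ⊆ κ
        A⊆κ z z∈ = let α , α∈ , e = to ∈img z∈ in subst (_∈ κ) (sym e) (subst (j α ∈_) jκ (j-∈ α∈))

        ¬representable-A : ¬ Representable A
        ¬representable-A (f , fn , e) = A-not-π fn (sym e)

        -- Coordinatewise complements in `κ` collapse to the complement in `j κ`, and `jκ` turns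
        -- this into `κ`. Thus `A′` in `M` would put `A` in `M`.
        complement : ∀ {y y′} → Fn y → Fn y′ → (∀ ξ x → ξ ∈ δ → x ∈ y′ · ξ ⇔ (x ∈ κ × ¬ x ∈ y · ξ)) →
                     ∀ z → z ∈ π y′ ⇔ (z ∈ κ × ¬ z ∈ π y)
        complement {y} {y′} fn fn′ h z = mk⇔
          (λ z∈ → let g , (gn , a , _) , z≡ = to (∈π fn′) z∈ in subst (λ z → z ∈ κ × ¬ z ∈ π y) (sym z≡)
            ( subst (π g ∈_) jκ (from (π∈j gn) (ae-mono (λ ξ ξ∈ p → proj₁ (to (h ξ (g · ξ) ξ∈) p)) a))
            , λ πg∈ → ae-absurd (to (π-∈ gn fn) πg∈) (ae-mono (λ ξ ξ∈ p → proj₂ (to (h ξ (g · ξ) ξ∈) p)) a)))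
          (λ (z∈ , z∉) → let g , (gn , a , _) , z≡ = to (∈π const-Fn) (subst (z ∈_) (sym jκ) z∈) in
            subst (_∈ π y′) (sym z≡) (from (π-∈ gn fn′) (ae-mono₂
              (λ ξ ξ∈ p n → from (h ξ (g · ξ) ξ∈) (subst (g · ξ ∈_) (const-· ξ∈) p , n))
              a (ae-¬ λ b → z∉ (subst (_∈ π y) (sym z≡) (from (π-∈ gn fn) b))))))

        ¬representable-A′ : ¬ Representable A′
        ¬representable-A′ (y , fn , e) = ¬representable-A (ƛ δ cut , ƛ-canonical , ext
          (λ z z∈ → from (∈complement z) (A⊆κ z z∈ , λ z∈πy → proj₂ (to ∈sep (subst (z ∈_) (sym e) z∈πy)) z∈))
          (λ z z∈ → let z∈κ , z∉ = to (∈complement z) z∈ in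
            byContradiction λ n → z∉ (subst (z ∈_) e (from ∈sep (z∈κ , n)))))
          where
          cut : V → V
          cut ξ = sep κ λ x → ¬ x ∈ y · ξ
          ∈cut : ∀ ξ x → x ∈ cut ξ ⇔ (x ∈ κ × ¬ x ∈ y · ξ)
          ∈cut ξ x = ∈sep
          ∈complement : ∀ z → z ∈ π (ƛ δ cut) ⇔ (z ∈ κ × ¬ z ∈ π y)
          ∈complement = complement fn ƛ-canonical λ ξ x ξ∈ → ∈cut ξ x ⇔-∘ ≡⇒⇔ (cong (x ∈_) (ƛ-· ξ∈))

        -- Complementary sets differ at any element of `κ`; `δ` is one.
        A≢A′ : ¬ A ≡ A′
        A≢A′ e = Sum.[ (λ h → proj₂ (to ∈sep (subst (δ ∈_) e h)) h)
                     , (λ n → n (subst (δ ∈_) (sym e) (from ∈sep (ν⊆κ δ δ∈ν , n)))) ]′ (decide (δ ∈ A))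

      -- The map on `Pκ` induced by `j`

      module _ {Pκ R : V} (isP : IsPowerSet Pκ κ) (good : IsGoodΣ₁WellOrdering (κ ∷ []) R Pκ) where
        private
          module WO = WellOrders (proj₂ (proj₁ good))

        S : V → V
        S a = sep Pκ λ x → ⟨ x , a ⟩ ∈ R

        JumpsTo : V → V → Set ℓ
        JumpsTo a u = u ∈ Pκ × (∀ x → x ∈ j (S a) ⇔ (x ∈ Pκ × ⟨ x , u ⟩ ∈ R))

        Falls : V → Set ℓ
        Falls a = ∃ λ u → JumpsTo a u × ⟨ u , a ⟩ ∈ R

        opaque
          jumps : ∀ {a} → a ∈ Pκ → ∃ λ u → JumpsTo a u
          jumps {a} a∈ =
            let φ , σ , d = proj₂ good
                s = to (d (S a)) (a , a∈ , λ x → (⇔-id _ ×-⇔ ⇔-sym related) ⇔-∘ ∈sep)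
                u , u∈ , h = from (d (j (S a))) (subst (λ k → Sat φ (j (S a) ∷ k ∷ [])) jκ (j-Σ₁ σ (S a ∷ κ ∷ []) s))
            in u , u∈ , λ x → (⇔-id _ ×-⇔ related) ⇔-∘ h x

          -- The set `j a` lies in between. It is in `j (S b)`, hence below `v`; it is not in
          -- `j (S a)`, because `a` is not in `S a`, hence not below `u`.
          jump-mono : ∀ {a b u v} → a ∈ Pκ → JumpsTo a u → JumpsTo b v → ⟨ a , b ⟩ ∈ R → ⟨ u , v ⟩ ∈ R
          jump-mono {a} {b} {u} {v} a∈ (u∈ , hu) (v∈ , hv) a<b =
            let ja∈ , ja<v = to (hv (j a)) (j-∈ (from ∈sep (a∈ , a<b)))
                ja∉ : ¬ j a ∈ j (S a)
                ja∉ h = let ξ , ξ∈ , p = ae-∃ (to (π∈j const-Fn) h)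
                        in WO.irrefl a a∈ (from related (proj₂ (to ∈sep (subst (_∈ S a) (const-· ξ∈) p))))
            in Sum.[ (λ h → ⊥-elim (ja∉ (from (hu (j a)) (ja∈ , to related h))))
                   , Sum.[ (λ e → subst (λ x → ⟨ x , v ⟩ ∈ R) e ja<v)
                         , (λ h → to related (WO.trans u (j a) v u∈ ja∈ v∈ h (from related ja<v))) ]′ ]′
                 (WO.total (j a) u ja∈ u∈)

          defFalls : Def {1} λ ρ → Falls (proj₁ ρ)
          defFalls = def∃

          ∈falling : ∀ {a} → a ∈ sep Pκ Falls ⇔ (a ∈ Pκ × Falls a)
          ∈falling = ∈sep ⦃ defFalls ⦄

          -- Let `m` be the least element mapped below itself, to `v`. By `jump-mono` the value at
          -- `v` is below `v`, so `v` is a smaller such element.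
          jump-inflationary : ∀ {a u} → a ∈ Pκ → JumpsTo a u → ¬ ⟨ u , a ⟩ ∈ R
          jump-inflationary {a} {u} a∈ hu u<a = absurd (WO.minimum (sep Pκ Falls)
            (λ z → proj₁ ∘ to ∈falling) (a , from ∈falling (a∈ , u , hu , u<a)))
            where
            absurd : (∃ λ m → m ∈ sep Pκ Falls × (∀ x → x ∈ sep Pκ Falls → m ≡ x ⊎ Related R m x)) → ⊥
            absurd (m , m∈ , min) =
              let m∈P , v , hv , v<m = to ∈falling m∈
                  v∈ = proj₁ hv
                  v′ , hv′ = jumps v∈
                  irr = WO.irrefl v v∈
              in Sum.[ (λ e → irr (subst (Related R v) e (from related v<m)))
                     , (λ m<v → irr (WO.trans v m v v∈ m∈P v∈ (from related v<m) m<v)) ]′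
                   (min v (from ∈falling (v∈ , v′ , hv′ , jump-mono v∈ hv′ hv v<m)))

          non-maximal-representable : ∀ {X Y} → X ∈ Pκ → Y ∈ Pκ → Related R X Y → Representable X
          non-maximal-representable {X} {Y} X∈ Y∈ X<Y =
            let u , hu = jumps X∈
                v , hv = jumps Y∈
                u<v = from related (jump-mono X∈ hu hv (to related X<Y))
                X<v = Sum.[ (λ h → WO.trans X u v X∈ (proj₁ hu) (proj₁ hv) h u<v)
                          , Sum.[ (λ e → subst (λ x → Related R x v) (sym e) u<v)
                                , (λ h → ⊥-elim (jump-inflationary X∈ hu (to related h))) ]′ ]′
                        (WO.total X u X∈ (proj₁ hu))
                g , g∈ , e = to (∈π const-Fn) (from (proj₂ hv X) (X∈ , to related X<v))
            in g , proj₁ g∈ , e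

          -- Being distinct, `A` and `A′` are comparable, and whichever comes first is not maximal,
          -- hence representable.
          contradiction : ⊥
          contradiction =
            let A∈  = from (isP A) A⊆κ
                A′∈ = from (isP A′) λ z → proj₁ ∘ to ∈sep
            in Sum.[ ¬representable-A ∘ non-maximal-representable A∈ A′∈
                   , Sum.[ A≢A′ , ¬representable-A′ ∘ non-maximal-representable A′∈ A∈ ]′ ]′ (WO.total A A′ A∈ A′∈)

lemma1p3 : ∀ {ℓ} → ExcludedMiddle ℓ → (𝓥 : Structure ℓ) →
    let open SetTheory 𝓥 in
    ZFC →
    ∀ δ ν → IsMeasurable δ →
    IsCardinal ν → δ ∈ ν → IsInaccessibleFor δ ν → ¬ IsCofinality δ ν →
    ∀ κ ν⁺ → IsSuccessorCardinal ν⁺ ν → IsCardinal κ → ν ≤ κ → κ ≤ ν⁺ →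
    ∀ Pκ → IsPowerSet Pκ κ →
    ¬ (∃[ R ] IsGoodΣ₁WellOrdering (κ ∷ []) R Pκ)
lemma1p3 em 𝓥 zfc δ ν ((cδ , w , isω , w∈δ) , U , uf , np , cp) cν δ∈ν inacc ¬cof κ ν⁺ s cκ ν≤κ κ≤ν⁺ Pκ isP (R , good) =
  Contradiction.contradiction uf np cp isω w∈δ cδ δ∈ν inacc cκ ν≤κ (fixed ν≤κ κ≤ν⁺) isP good
  where
  open Proof em 𝓥 zfc
  open Ultrapower uf np cp isω w∈δ using (j; j-ν; j-ν⁺)

  -- No cardinal lies strictly between `ν` and `ν⁺`, so `κ` is one of these two fixed points.
  fixed : ν ≤ κ → κ ≤ ν⁺ → j κ ≡ κ
  fixed (inj₂ refl) _           = j-ν cν δ∈ν inacc ¬cof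
  fixed (inj₁ _)    (inj₂ refl) = j-ν⁺ cν δ∈ν inacc ¬cof s
  fixed (inj₁ ν∈κ)  (inj₁ κ∈ν⁺) with proj₂ (proj₂ s) κ cκ ν∈κ
  ... | inj₁ ν⁺∈κ = ⊥-elim (∈-asym ν⁺∈κ κ∈ν⁺)
  ... | inj₂ refl = ⊥-elim (∈-irrefl κ∈ν⁺)
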